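{- Let $0\le k\le n$, let $A=(a_{i,j})\in\mathbb{R}^{n\times n}$ be a Monge matrix and $B=(b_{i,j})\in\mathbb{R}^{n\times n}$ an Anti-Monge matrix, and consider RecovAP with $c_1(\{u_i,v_j\})=a_{i,j}$ and $c_2(\{u_i,v_j\})=b_{i,j}$. Let $m=\lfloor\frac{n-k}{2}\rfloor$ and $I=\{1,\dots,m\}\cup\{n+1-m,\dots,n\}$. Then there exists an optimal solution $M_1,M_2$ such that (1) $\{u_i,v_i\}\in M_1$ for all $i\in I$; (2) $\{u_i,v_{n+1-i}\}\in M_2$ for all $i\in I$; (3) $M_1\cap M_2$ is an optimal solution of the assignment problem with cost $c_1+c_2$ (i.e. a minimum-cost perfect matching with respect to $c_1+c_2$) on the complete bipartite subgraph induced by $\{u_i: m+1\le i\le n-m\}$ and $\{v_i: m+1\le i\le n-m\}$.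
   Context: $K_{n,n}$ has vertex classes $U=\{u_1,\dots,u_n\}$, $V=\{v_1,\dots,v_n\}$. RecovAP: given $c_1,c_2:E(K_{n,n})\to\mathbb{R}$ and an integer $k$, find perfect matchings $M_1,M_2$ of $K_{n,n}$ with $|M_1\cap M_2|\ge k$ minimizing $c_1(M_1)+c_2(M_2)$; an optimal solution is a minimizing feasible pair. A matrix $A$ is Monge if $a_{i,j}+a_{k,l}\le a_{i,l}+a_{k,j}$ for all $i<k$, $j<l$; a matrix $B$ is Anti-Monge if $b_{i,j}+b_{k,l}\ge b_{i,l}+b_{k,j}$ for all $i<k$, $j<l$. -}

module Defs where

open import Data.Bool.Base using (if_then_else_)
open import Data.Fin.Base as Fin using (Fin; toℕ)
open import Data.Fin.Subset as Subset using (Subset; _∈_)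
open import Data.Nat.Base as ℕ using (ℕ; suc; _∸_)
open import Data.Product using (_×_; _,_; ∃; ∃₂; ∃!)
open import Data.Rational.Base as ℚ using (ℚ; 0ℚ; 1ℚ)
import Data.Rational.Properties as ℚ
open import Data.Sum.Base using (_⊎_)
open import Data.Vec.Base using (lookup)
open import Data.Vec.Functional using (foldr)
open import Level using (0ℓ)
open import Relation.Binary.Definitions using (tri<; tri≈; tri>)
open import Relation.Binary.PropositionalEquality
open import Relation.Nullary using (¬_; contradiction)
open import Relation.Unary using (Pred; U; _⊆_)

-- The additive ordered structure of the real numbers, as Dedekind cuts in
-- the form used by Rudin: a real is a nonempty proper subset of ℚ that is
-- downward closed and has no greatest element.  These are the classical
-- reals; results about them may need excluded middle (for instance for
-- the totality of _≤_).

record ℝ : Set₁ where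
  field
    cut      : Pred ℚ 0ℓ
    nonempty : ∃ λ p → cut p
    proper   : ∃ λ p → ¬ cut p
    downward : ∀ {p q} → p ℚ.< q → cut q → cut p
    open-top : ∀ {p} → cut p → ∃ λ q → p ℚ.< q × cut q

open ℝ

infix  4 _≤_
infixl 6 _+_

_≤_ : ℝ → ℝ → Set
x ≤ y = cut x ⊆ cut y

0ℝ : ℝ
0ℝ = record
  { cut      = ℚ._< 0ℚ
  ; nonempty = ℚ.- 1ℚ , ℚ.negative⁻¹ (ℚ.- 1ℚ)
  ; proper   = 0ℚ , ℚ.<-irrefl refl
  ; downward = ℚ.<-trans
  ; open-top = ℚ.<-dense
  }

private
  below : ∀ (x : ℝ) {p b} → cut x p → ¬ cut x b → p ℚ.< b
  below x {p} {b} p∈x b∉x with ℚ.<-cmp p b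
  ... | tri< p<b _ _ = p<b
  ... | tri≈ _ refl _ = contradiction p∈x b∉x
  ... | tri> _ _ b<p = contradiction (downward x b<p p∈x) b∉x

  x-y+y : ∀ x y → (x ℚ.+ ℚ.- y) ℚ.+ y ≡ x
  x-y+y x y = begin
    (x ℚ.+ ℚ.- y) ℚ.+ y  ≡⟨ ℚ.+-assoc x (ℚ.- y) y ⟩
    x ℚ.+ (ℚ.- y ℚ.+ y)  ≡⟨ cong (x ℚ.+_) (ℚ.+-inverseˡ y) ⟩
    x ℚ.+ 0ℚ             ≡⟨ ℚ.+-identityʳ x ⟩
    x                    ∎
    where open ≡-Reasoning

  x+y-y : ∀ x y → (x ℚ.+ y) ℚ.+ ℚ.- y ≡ x
  x+y-y x y = begin
    (x ℚ.+ y) ℚ.+ ℚ.- y  ≡⟨ ℚ.+-assoc x y (ℚ.- y) ⟩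
    x ℚ.+ (y ℚ.+ ℚ.- y)  ≡⟨ cong (x ℚ.+_) (ℚ.+-inverseʳ y) ⟩
    x ℚ.+ 0ℚ             ≡⟨ ℚ.+-identityʳ x ⟩
    x                    ∎
    where open ≡-Reasoning

_+_ : ℝ → ℝ → ℝ
x + y = record
  { cut      = sumset
  ; nonempty = nonempty′ (nonempty x) (nonempty y)
  ; proper   = proper′ (proper x) (proper y)
  ; downward = downward′
  ; open-top = open-top′
  }
  where
  sumset : Pred ℚ 0ℓ
  sumset r = ∃₂ λ p q → cut x p × cut y q × r ≡ p ℚ.+ q

  nonempty′ : (∃ λ p → cut x p) → (∃ λ q → cut y q) → ∃ λ r → sumset r
  nonempty′ (p , p∈x) (q , q∈y) = p ℚ.+ q , p , q , p∈x , q∈y , refl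

  proper′ : (∃ λ b → ¬ cut x b) → (∃ λ c → ¬ cut y c) → ∃ λ r → ¬ sumset r
  proper′ (b , b∉x) (c , c∉y) = b ℚ.+ c , b+c∉
    where
    b+c∉ : ¬ sumset (b ℚ.+ c)
    b+c∉ (p , q , p∈x , q∈y , b+c≡p+q) =
      ℚ.<-irrefl (sym b+c≡p+q)
        (ℚ.+-mono-< (below x p∈x b∉x) (below y q∈y c∉y))

  downward′ : ∀ {r s} → r ℚ.< s → sumset s → sumset r
  downward′ {r} r<s (p , q , p∈x , q∈y , refl) =
    r ℚ.+ ℚ.- q , q , downward x r-q<p p∈x , q∈y , sym (x-y+y r q)
    where
    r-q<p : r ℚ.+ ℚ.- q ℚ.< p
    r-q<p = subst (r ℚ.+ ℚ.- q ℚ.<_) (x+y-y p q) (ℚ.+-monoˡ-< (ℚ.- q) r<s)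

  open-top′ : ∀ {r} → sumset r → ∃ λ s → r ℚ.< s × sumset s
  open-top′ (p , q , p∈x , q∈y , refl) with open-top x p∈x
  ... | p′ , p<p′ , p′∈x =
    p′ ℚ.+ q , ℚ.+-monoˡ-< q p<p′ , p′ , q , p′∈x , q∈y , refl

∑ : ∀ {n} → (Fin n → ℝ) → ℝ
∑ = foldr _+_ 0ℝ

Matrix : ℕ → Set₁
Matrix n = Fin n → Fin n → ℝ

Monge : ∀ {n} → Matrix n → Set
Monge a = ∀ i k j l → i Fin.< k → j Fin.< l →
          a i j + a k l ≤ a i l + a k j

AntiMonge : ∀ {n} → Matrix n → Set
AntiMonge b = ∀ i k j l → i Fin.< k → j Fin.< l →
              b i l + b k j ≤ b i j + b k l

-- A set of edges of K_{n,n}: M i is the set of all j with {u_i , v_j} in M.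

EdgeSet : ℕ → Set
EdgeSet n = Fin n → Subset n

[u_,v_]∈_ : ∀ {n} → Fin n → Fin n → EdgeSet n → Set
[u i ,v j ]∈ M = j ∈ M i

infixr 7 _∩_

_∩_ : ∀ {n} → EdgeSet n → EdgeSet n → EdgeSet n
(M ∩ N) i = M i Subset.∩ N i

∣_∣ : ∀ {n} → EdgeSet n → ℕ
∣ M ∣ = foldr ℕ._+_ 0 (λ i → Subset.∣ M i ∣)

cost : ∀ {n} → (Fin n → Fin n → ℝ) → EdgeSet n → ℝ
cost c M = ∑ λ i → ∑ λ j → if lookup (M i) j then c i j else 0ℝ

-- M is a perfect matching of the subgraph of K_{n,n} induced by
-- {u_i : S i} and {v_j : T j}.

record IsPerfectMatchingOn {n} (S T : Pred (Fin n) 0ℓ) (M : EdgeSet n) : Set where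
  field
    inside  : ∀ {i j} → [u i ,v j ]∈ M → S i × T j
    coversU : ∀ {i} → S i → ∃! _≡_ λ j → [u i ,v j ]∈ M
    coversV : ∀ {j} → T j → ∃! _≡_ λ i → [u i ,v j ]∈ M

IsPerfectMatching : ∀ {n} → EdgeSet n → Set
IsPerfectMatching = IsPerfectMatchingOn U U

record IsMinCostPerfectMatchingOn {n} (S T : Pred (Fin n) 0ℓ)
         (c : Fin n → Fin n → ℝ) (M : EdgeSet n) : Set where
  field
    perfect : IsPerfectMatchingOn S T M
    minimal : ∀ N → IsPerfectMatchingOn S T N → cost c M ≤ cost c N

module RecovAP {n} (c₁ c₂ : Fin n → Fin n → ℝ) (k : ℕ) where

  record Feasible (M₁ M₂ : EdgeSet n) : Set where
    field
      perfect₁ : IsPerfectMatching M₁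
      perfect₂ : IsPerfectMatching M₂
      common   : k ℕ.≤ ∣ M₁ ∩ M₂ ∣

  record Optimal (M₁ M₂ : EdgeSet n) : Set where
    field
      feasible : Feasible M₁ M₂
      minimal  : ∀ N₁ N₂ → Feasible N₁ N₂ →
                 cost c₁ M₁ + cost c₂ M₂ ≤ cost c₁ N₁ + cost c₂ N₂

-- The position of a vertex in the numbering 1,…,n (Fin n starts at 0).

index : ∀ {n} → Fin n → ℕ
index i = suc (toℕ i)

-- {1,…,m} ∪ {n+1-m,…,n}; used only for m ≤ n, so that ∸ is subtraction.

Outer : ∀ {n} → ℕ → Pred (Fin n) 0ℓ
Outer {n} m i = index i ℕ.≤ m ⊎ suc n ∸ m ℕ.≤ index i

-- {m+1,…,n-m}

Middle : ∀ {n} → ℕ → Pred (Fin n) 0ℓ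
Middle {n} m i = suc m ℕ.≤ index i × index i ℕ.≤ n ∸ m

{-# OPTIONS --safe #-}
-- Feasible pairs are rearranged without raising the cost or losing a common
-- edge.  Uncrossing two edges is cheap in M₁ by the Monge property, crossing two
-- edges is cheap in M₂ by the Anti-Monge property.  Hence, among the edges that
-- are not common, M₁ may be taken to contain (r , c) and (r′ , c′), and M₂ to
-- contain (r , c′) and (r′ , c), for the extreme rows r, r′ and the extreme
-- columns c, c′.  Now take any common edge e: sorting (r , c), (r′ , c′), e
-- increasingly in M₁ and (r , c′), (r′ , c), e decreasingly in M₂ puts the
-- extremes of the three rows and columns at the corners and leaves the median
-- edge in both matchings.  After all common edges have been treated this way, the
-- corners are extreme among all rows and columns; peel them off and repeat.
-- When at most one non-common edge is left in each matching, these edges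
-- coincide, so the matchings agree on the remaining middle part.

module Submission where

open import Defs
open import Algebra.Bundles using (CommutativeMonoid)
open import Axiom.ExcludedMiddle using (ExcludedMiddle)
open import Data.Bool.Base using (Bool; true; false; if_then_else_)
open import Data.Bool.Properties using (T?; T-≡)
open import Data.Fin.Base as Fin using (Fin; toℕ; fromℕ<; opposite)
import Data.Fin.Properties as Fin
open import Data.Fin.Subset as Subset using (Subset)
open import Data.Fin.Subset.Properties using (x∈p∩q⁺; x∈p∩q⁻)
open import Data.List.Base as List using (List; []; _∷_; _++_; map; length; filter; tabulate; allFin; take; cartesianProduct; cartesianProductWith)
import Data.List.Membership.DecPropositional as DecMembership
open import Data.List.Membership.Propositional using () renaming (_∈_ to _∈ₗ_)
open import Data.List.Membership.Propositional.Properties using (∈-allFin; ∈-filter⁺; ∈-filter⁻; ∈-++⁺ˡ; ∈-++⁺ʳ; ∈-++⁻; ∈-map⁺; ∈-map⁻; ∈-∃++; ∈-cartesianProduct⁺; ∈-cartesianProductWith⁺)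
open import Data.List.Membership.Propositional.Properties.WithK using (unique∧set⇒bag)
open import Data.List.Properties using (map-++; length-map; length-++; filter-none)
import Data.List.Properties as List
open import Data.List.Relation.Binary.BagAndSetEquality using (∼bag⇒↭)
open import Data.List.Relation.Binary.Permutation.Propositional as ↭ using (_↭_; ↭-refl; ↭-sym; ↭-trans; ↭-reflexive)
open import Data.List.Relation.Binary.Permutation.Propositional.Properties hiding (sum-↭)
open import Data.List.Relation.Binary.Permutation.Setoid.Properties using (Unique-resp-↭)
open import Data.List.Relation.Unary.All as All using (All; []; _∷_)
import Data.List.Relation.Unary.All.Properties as All
open import Data.List.Relation.Unary.Any using (here; there)
open import Data.List.Relation.Unary.Unique.Propositional using (Unique; []; _∷_)
import Data.List.Relation.Unary.Unique.Propositional.Properties as Unique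
open import Data.Nat.Base as ℕ using (ℕ; zero; suc; _∸_; ⌊_/2⌋) renaming (_≤_ to _≤ℕ_)
import Data.Nat.Properties as ℕ
open import Data.Product using (_×_; _,_; ∃; ∃₂; ∃!; proj₁; proj₂; uncurry)
open import Data.Product.Properties using (≡-dec)
open import Data.Rational.Base as ℚ using (0ℚ)
import Data.Rational.Properties as ℚ
open import Data.Sum.Base using (_⊎_; inj₁; inj₂)
open import Data.Vec.Base as Vec using (lookup; []; _∷_)
open import Data.Vec.Functional using () renaming (foldr to foldrᶠ)
open import Data.Vec.Properties using (lookup⇒[]=; []=⇒lookup; lookup∘tabulate)
open import Function.Base using (_∘_; id; flip)
open import Function.Bundles using (_⇔_; mk⇔; Equivalence)
open import Level using (0ℓ)
open import Relation.Binary.Bundles using (Poset)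
import Relation.Binary.Construct.Flip.EqAndOrd as Flip
open import Relation.Binary.Core using (Rel)
open import Relation.Binary.Definitions using (tri<; tri≈; tri>)
open import Relation.Binary.PropositionalEquality as ≡ using (_≡_; _≢_; refl; cong; cong₂; subst)
open import Relation.Binary.Structures using (IsTotalOrder)
open import Relation.Nullary using (¬_; Dec; yes; no; contradiction)
open import Relation.Nullary.Decidable using (¬?; _×-dec_; does; dec-true)
open import Relation.Unary using (Pred; U)

-- The reals as a totally ordered commutative monoid

open ℝ

-- A record, since Agda cannot recover x and y from the unfolding of x ≤ y.
infix 4 _≼_ _≈_
record _≼_ (x y : ℝ) : Set where
  constructor ⟨_⟩
  field ⊆-cut : x ≤ y

open _≼_

_≈_ : ℝ → ℝ → Set
x ≈ y = x ≼ y × y ≼ x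

≼-refl : ∀ {x} → x ≼ x
≼-refl = ⟨ id ⟩

≼-trans : ∀ {x y z} → x ≼ y → y ≼ z → x ≼ z
≼-trans x≼y y≼z = ⟨ ⊆-cut y≼z ∘ ⊆-cut x≼y ⟩

-- If `x ≼ y` fails, excluded middle yields a rational in `x` but not in `y`. It bounds `y` from
-- above, so downward closure of `x` puts all of `y` into `x`.
≼-total : ExcludedMiddle 0ℓ → ∀ x y → x ≼ y ⊎ y ≼ x
≼-total em x y with em {x ≼ y} | em {∃ λ p → cut x p × ¬ cut y p}
... | yes x≼y | _ = inj₁ x≼y
... | no x⋠y | no ∄ = contradiction ⟨ (λ {p} → cut-⊆ p) ⟩ x⋠y
  where
  cut-⊆ : ∀ p → cut x p → cut y p
  cut-⊆ p p∈x with em {cut y p}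
  ... | yes p∈y = p∈y
  ... | no p∉y = contradiction (p , p∈x , p∉y) ∄
... | no _ | yes (p , p∈x , p∉y) = inj₂ ⟨ (λ {q} → cut-⊇ q) ⟩
  where
  cut-⊇ : ∀ q → cut y q → cut x q
  cut-⊇ q q∈y with ℚ.<-cmp q p
  ... | tri< q<p _ _ = downward x q<p p∈x
  ... | tri≈ _ refl _ = p∈x
  ... | tri> _ _ p<q = contradiction (downward y p<q q∈y) p∉y

+-mono : ∀ {x x′ y y′} → x ≼ x′ → y ≼ y′ → x + y ≼ x′ + y′
+-mono x≼x′ y≼y′ = ⟨ (λ (p , q , p∈x , q∈y , eq) → p , q , ⊆-cut x≼x′ p∈x , ⊆-cut y≼y′ q∈y , eq) ⟩

+-comm-≼ : ∀ x y → x + y ≼ y + x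
+-comm-≼ x y = ⟨ (λ (p , q , p∈x , q∈y , eq) → q , p , q∈y , p∈x , ≡.trans eq (ℚ.+-comm p q)) ⟩

+-assoc : ∀ x y z → (x + y) + z ≈ x + (y + z)
+-assoc x y z =
  ⟨ (λ { (_ , r , (p , q , p∈x , q∈y , refl) , r∈z , eq) →
      p , q ℚ.+ r , p∈x , (q , r , q∈y , r∈z , refl) , ≡.trans eq (ℚ.+-assoc p q r) }) ⟩ ,
  ⟨ (λ { (p , _ , p∈x , (q , r , q∈y , r∈z , refl) , eq) →
      p ℚ.+ q , r , (p , q , p∈x , q∈y , refl) , r∈z , ≡.trans eq (≡.sym (ℚ.+-assoc p q r)) }) ⟩

+-identityʳ : ∀ x → x + 0ℝ ≈ x
+-identityʳ x = ⟨ (λ { (p , q , p∈x , q<0 , refl) → downward x (p+q<p p q<0) p∈x }) ⟩ , ⟨ (λ {p} → x≼x+0 p) ⟩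
  where
  p+q<p : ∀ p {q} → q ℚ.< 0ℚ → p ℚ.+ q ℚ.< p
  p+q<p p {q} q<0 = subst (p ℚ.+ q ℚ.<_) (ℚ.+-identityʳ p) (ℚ.+-monoʳ-< p q<0)

  x≼x+0 : ∀ p → cut x p → cut (x + 0ℝ) p
  -- Since `x` has no greatest element, some larger `p′` in `x` leaves the strictly negative
  -- remainder `p ℚ.- p′` for the second summand.
  x≼x+0 p p∈x with open-top x p∈x
  ... | p′ , p<p′ , p′∈x = p′ , p ℚ.- p′ , p′∈x , p-p′<0 , p≡
    where
    p-p′<0 : p ℚ.- p′ ℚ.< 0ℚ
    p-p′<0 = subst (p ℚ.- p′ ℚ.<_) (ℚ.+-inverseʳ p′) (ℚ.+-monoˡ-< (ℚ.- p′) p<p′)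

    open ≡.≡-Reasoning
    p≡ : p ≡ p′ ℚ.+ (p ℚ.- p′)
    p≡ = begin
      p                         ≡⟨ ℚ.+-identityʳ p ⟨
      p ℚ.+ 0ℚ                  ≡⟨ cong (p ℚ.+_) (ℚ.+-inverseˡ p′) ⟨
      p ℚ.+ (ℚ.- p′ ℚ.+ p′)     ≡⟨ ℚ.+-assoc p (ℚ.- p′) p′ ⟨
      (p ℚ.- p′) ℚ.+ p′         ≡⟨ ℚ.+-comm (p ℚ.- p′) p′ ⟩
      p′ ℚ.+ (p ℚ.- p′)         ∎

≼-poset : Poset _ 0ℓ 0ℓ
≼-poset = record
  { Carrier = ℝ ; _≈_ = _≈_ ; _≤_ = _≼_
  ; isPartialOrder = record
    { isPreorder = record
      { isEquivalence = record
        { refl = ≼-refl , ≼-refl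
        ; sym = λ (p , q) → q , p
        ; trans = λ (p , q) (p′ , q′) → ≼-trans p p′ , ≼-trans q′ q }
      ; reflexive = proj₁
      ; trans = ≼-trans }
    ; antisym = _,_ } }

+-0-commutativeMonoid : CommutativeMonoid _ 0ℓ
+-0-commutativeMonoid = record
  { Carrier = ℝ ; _≈_ = _≈_ ; _∙_ = _+_ ; ε = 0ℝ
  ; isCommutativeMonoid = record
    { isMonoid = record
      { isSemigroup = record
        { isMagma = record
          { isEquivalence = Poset.isEquivalence ≼-poset
          ; ∙-cong = λ (p , q) (p′ , q′) → +-mono p p′ , +-mono q q′ }
        ; assoc = +-assoc }
      ; identity = (λ x → ≈.trans (+-comm 0ℝ x) (+-identityʳ x)) , +-identityʳ }
    ; comm = +-comm } }
  where
  module ≈ = Poset.Eq ≼-poset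
  +-comm : ∀ x y → x + y ≈ y + x
  +-comm x y = +-comm-≼ x y , +-comm-≼ y x

-- Sums over lists in a commutative monoid

module ListSum {a ℓ} (M : CommutativeMonoid a ℓ) where

  open CommutativeMonoid M renaming (_≈_ to _≋_; refl to ≋-refl; sym to ≋-sym)
  open import Algebra.Properties.CommutativeSemigroup commutativeSemigroup using (interchange; x∙yz≈y∙xz)
  open import Relation.Binary.Reasoning.Setoid setoid

  sum : ∀ {E : Set} → (E → Carrier) → List E → Carrier
  sum f = List.foldr (λ e s → f e ∙ s) ε

  module _ {E : Set} (f : E → Carrier) where

    sum-++ : ∀ xs ys → sum f (xs ++ ys) ≋ sum f xs ∙ sum f ys
    sum-++ []       ys = ≋-sym (identityˡ _)
    sum-++ (x ∷ xs) ys = begin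
      f x ∙ sum f (xs ++ ys)       ≈⟨ ∙-congˡ (sum-++ xs ys) ⟩
      f x ∙ (sum f xs ∙ sum f ys)  ≈⟨ assoc _ _ _ ⟨
      f x ∙ sum f xs ∙ sum f ys    ∎

    sum-↭ : ∀ {xs ys} → xs ↭ ys → sum f xs ≋ sum f ys
    sum-↭ ↭.refl = ≋-refl
    sum-↭ (↭.prep x p) = ∙-congˡ (sum-↭ p)
    sum-↭ (↭.swap x y p) = trans (∙-congˡ (∙-congˡ (sum-↭ p))) (x∙yz≈y∙xz _ _ _)
    sum-↭ (↭.trans p q) = trans (sum-↭ p) (sum-↭ q)

    sum-filter : ∀ (p : E → Bool) xs →
                 sum f (filter (T? ∘ p) xs) ≋ sum (λ e → if p e then f e else ε) xs
    sum-filter p [] = ≋-refl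
    sum-filter p (x ∷ xs) with p x
    ... | true = ∙-congˡ (sum-filter p xs)
    ... | false = trans (sum-filter p xs) (≋-sym (identityˡ _))

    sum-tabulate : ∀ {n} (g : Fin n → E) → sum f (tabulate g) ≡ foldrᶠ _∙_ ε (f ∘ g)
    sum-tabulate {zero} g = refl
    sum-tabulate {suc n} g = cong (f (g Fin.zero) ∙_) (sum-tabulate (g ∘ Fin.suc))

    sum-map : ∀ {D : Set} (g : D → E) xs → sum f (map g xs) ≡ sum (f ∘ g) xs
    sum-map g [] = refl
    sum-map g (x ∷ xs) = cong (f (g x) ∙_) (sum-map g xs)

    sum-∙ : ∀ (g : E → Carrier) xs → sum (λ e → f e ∙ g e) xs ≋ sum f xs ∙ sum g xs
    sum-∙ g [] = ≋-sym (identityˡ ε)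
    sum-∙ g (x ∷ xs) = trans (∙-congˡ (sum-∙ g xs)) (interchange _ _ _ _)

  -- Bridges list sums to the nested `foldr` of `cost` and, through `∣∣-as-sum`, of `∣_∣`; the
  -- monoid is arbitrary so that real costs and edge counts are both covered.
  sum-cartesianProduct : ∀ {m n} {D E : Set} (f : D × E → Carrier) (g : Fin m → D) (h : Fin n → E) →
    sum f (cartesianProduct (tabulate g) (tabulate h)) ≋ foldrᶠ _∙_ ε (λ i → foldrᶠ _∙_ ε (λ j → f (g i , h j)))
  sum-cartesianProduct {zero} f g h = ≋-refl
  sum-cartesianProduct {suc m} f g h = begin
    sum f (map (g₀ ,_) (tabulate h) ++ rest)          ≈⟨ sum-++ f (map (g₀ ,_) (tabulate h)) rest ⟩
    sum f (map (g₀ ,_) (tabulate h)) ∙ sum f rest     ≈⟨ ∙-cong (reflexive first) (sum-cartesianProduct f (g ∘ Fin.suc) h) ⟩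
    _                                                 ∎
    where
    g₀ = g Fin.zero
    rest = cartesianProduct (tabulate (g ∘ Fin.suc)) (tabulate h)
    first : sum f (map (g₀ ,_) (tabulate h)) ≡ foldrᶠ _∙_ ε (λ j → f (g₀ , h j))
    first = ≡.trans (sum-map f (g₀ ,_) (tabulate h)) (sum-tabulate (f ∘ (g₀ ,_)) h)

open ListSum +-0-commutativeMonoid using (sum; sum-++; sum-↭; sum-filter; sum-∙; sum-cartesianProduct)

module ≼-Reasoning where
  open import Relation.Binary.Reasoning.PartialOrder ≼-poset public

-- Improving lists of edges

Edge : ℕ → Set
Edge n = Fin n × Fin n

rows cols : ∀ {n} → List (Edge n) → List (Fin n)
rows = map proj₁
cols = map proj₂

total : ∀ {n} → Matrix n → List (Edge n) → ℝ
total c = sum (uncurry c)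

infix 4 _⇝[_]_
-- Perfectness depends only on the multisets of rows and of columns, so every step that keeps these
-- two multisets keeps it; the pairing of rows with columns is free to change.
record _⇝[_]_ {n} (xs : List (Edge n)) (c : Matrix n) (ys : List (Edge n)) : Set where
  field
    rows-↭ : rows xs ↭ rows ys
    cols-↭ : cols xs ↭ cols ys
    cheaper : total c ys ≼ total c xs

open _⇝[_]_

module _ {n} {c : Matrix n} where

  ↭⇒⇝ : ∀ {xs ys} → xs ↭ ys → xs ⇝[ c ] ys
  ↭⇒⇝ xs↭ys = record
    { rows-↭ = map⁺ proj₁ xs↭ys
    ; cols-↭ = map⁺ proj₂ xs↭ys
    ; cheaper = proj₂ (sum-↭ (uncurry c) xs↭ys) }

  ⇝-refl : ∀ {xs} → xs ⇝[ c ] xs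
  ⇝-refl = ↭⇒⇝ ↭-refl

  infixr 4 _⨾_
  _⨾_ : ∀ {xs ys zs} → xs ⇝[ c ] ys → ys ⇝[ c ] zs → xs ⇝[ c ] zs
  p ⨾ q = record
    { rows-↭ = ↭-trans (rows-↭ p) (rows-↭ q)
    ; cols-↭ = ↭-trans (cols-↭ p) (cols-↭ q)
    ; cheaper = ≼-trans (cheaper q) (cheaper p) }

  ⇝-∷ : ∀ e {xs ys} → xs ⇝[ c ] ys → e ∷ xs ⇝[ c ] e ∷ ys
  ⇝-∷ e p = record
    { rows-↭ = ↭.prep _ (rows-↭ p)
    ; cols-↭ = ↭.prep _ (cols-↭ p)
    ; cheaper = +-mono ≼-refl (cheaper p) }

  ⇝-++ˡ : ∀ zs {xs ys} → xs ⇝[ c ] ys → zs ++ xs ⇝[ c ] zs ++ ys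
  ⇝-++ˡ [] p = p
  ⇝-++ˡ (z ∷ zs) p = ⇝-∷ z (⇝-++ˡ zs p)

  ⇝-++ʳ : ∀ zs {xs ys} → xs ⇝[ c ] ys → xs ++ zs ⇝[ c ] ys ++ zs
  ⇝-++ʳ zs {xs} {ys} p = ↭⇒⇝ (++-comm xs zs) ⨾ ⇝-++ˡ zs p ⨾ ↭⇒⇝ (++-comm zs ys)

-- Monge inequalities and extraction of extreme rows and columns

-- The two orders are parameters so that one argument serves all uses: Anti-Monge becomes Monge when
-- the column order is reversed, and greatest elements are least ones for reversed orders.
WeakMonge : ∀ {n} → Rel (Fin n) 0ℓ → Rel (Fin n) 0ℓ → Matrix n → Set
WeakMonge _⊑ᵣ_ _⊑ᶜ_ c = ∀ {i k j l} → i ⊑ᵣ k → j ⊑ᶜ l → c i j + c k l ≼ c i l + c k j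

-- Reversing both orders only swaps the two summands on each side.
WeakMonge-flip : ∀ {n} {_⊑ᵣ_ _⊑ᶜ_} {c : Matrix n} →
                 WeakMonge _⊑ᵣ_ _⊑ᶜ_ c → WeakMonge (flip _⊑ᵣ_) (flip _⊑ᶜ_) c
WeakMonge-flip weak k⊑i l⊑j = ≼-trans (+-comm-≼ _ _) (≼-trans (weak k⊑i l⊑j) (+-comm-≼ _ _))

module Extraction {n} {_⊑ᵣ_ _⊑ᶜ_ : Rel (Fin n) 0ℓ}
  (totalᵣ : IsTotalOrder _≡_ _⊑ᵣ_) (totalᶜ : IsTotalOrder _≡_ _⊑ᶜ_)
  {c : Matrix n} (weak : WeakMonge _⊑ᵣ_ _⊑ᶜ_ c) where

  private
    module R = IsTotalOrder totalᵣ
    module C = IsTotalOrder totalᶜ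

  -- The smaller row and the smaller column of two edges are brought together in the first edge. The
  -- bounds by `r` and `s` let a chain of exchanges track a decreasing minimum.
  record Exchange (r s x y : Fin n) : Set where
    field
      {r₁ s₁ x₁ y₁} : Fin n
      improves : (r , s) ∷ (x , y) ∷ [] ⇝[ c ] (r₁ , s₁) ∷ (x₁ , y₁) ∷ []
      r₁⊑r  : r₁ ⊑ᵣ r
      r₁⊑x₁ : r₁ ⊑ᵣ x₁
      s₁⊑s  : s₁ ⊑ᶜ s
      s₁⊑y₁ : s₁ ⊑ᶜ y₁

  exchange : ∀ r s x y → Exchange r s x y
  exchange r s x y with R.total r x | C.total s y
  ... | inj₁ r⊑x | inj₁ s⊑y = record
    { improves = ⇝-refl ; r₁⊑r = R.refl ; r₁⊑x₁ = r⊑x ; s₁⊑s = C.refl ; s₁⊑y₁ = s⊑y }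
  ... | inj₂ x⊑r | inj₂ y⊑s = record
    { improves = ↭⇒⇝ (↭.swap _ _ ↭-refl) ; r₁⊑r = x⊑r ; r₁⊑x₁ = x⊑r ; s₁⊑s = y⊑s ; s₁⊑y₁ = y⊑s }
  -- The edges cross: trading their columns is exactly the `WeakMonge` inequality. The trailing `0ℝ`
  -- comes from the end of the list sum.
  ... | inj₁ r⊑x | inj₂ y⊑s = record
    { improves = record
      { rows-↭ = ↭-refl
      ; cols-↭ = ↭.swap _ _ ↭-refl
      ; cheaper = begin
          c r y + (c x s + 0ℝ)  ≈⟨ +-assoc _ _ _ ⟨
          c r y + c x s + 0ℝ    ≤⟨ +-mono (weak r⊑x y⊑s) ≼-refl ⟩
          c r s + c x y + 0ℝ    ≈⟨ +-assoc _ _ _ ⟩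
          c r s + (c x y + 0ℝ)  ∎ }
    ; r₁⊑r = R.refl ; r₁⊑x₁ = r⊑x ; s₁⊑s = y⊑s ; s₁⊑y₁ = y⊑s }
    where open ≼-Reasoning
  -- Here `x` is the smaller row, so the uncrossed pair is `(x , s)`, `(r , y)`.
  ... | inj₂ x⊑r | inj₁ s⊑y = record
    { improves = record
      { rows-↭ = ↭.swap _ _ ↭-refl
      ; cols-↭ = ↭-refl
      ; cheaper = begin
          c x s + (c r y + 0ℝ)  ≈⟨ +-assoc _ _ _ ⟨
          c x s + c r y + 0ℝ    ≤⟨ +-mono (weak x⊑r s⊑y) ≼-refl ⟩
          c x y + c r s + 0ℝ    ≤⟨ +-mono (+-comm-≼ _ _) ≼-refl ⟩
          c r s + c x y + 0ℝ    ≈⟨ +-assoc _ _ _ ⟩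
          c r s + (c x y + 0ℝ)  ∎ }
    ; r₁⊑r = x⊑r ; r₁⊑x₁ = x⊑r ; s₁⊑s = C.refl ; s₁⊑y₁ = s⊑y }
    where open ≼-Reasoning

  record Least (xs : List (Edge n)) : Set where
    field
      {r s} : Fin n
      {rest} : List (Edge n)
      improves : xs ⇝[ c ] (r , s) ∷ rest
      least-row : All (r ⊑ᵣ_) (rows rest)
      least-col : All (s ⊑ᶜ_) (cols rest)

  -- A single pass carries the edge with the smallest row and column seen so far. The two extra
  -- bounds in `go` say that later exchanges only lower it, so edges set aside earlier stay above
  -- it.
  extract-least : ∀ e xs → Least (e ∷ xs)
  extract-least (r , s) xs = let L , _ , _ = go r s xs in L
    where
    open Exchange using (r₁⊑r; r₁⊑x₁; s₁⊑s; s₁⊑y₁)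

    go : ∀ r s xs → ∃ λ (L : Least ((r , s) ∷ xs)) → Least.r L ⊑ᵣ r × Least.s L ⊑ᶜ s
    go r s [] = record { improves = ⇝-refl ; least-row = [] ; least-col = [] } , R.refl , C.refl
    go r s ((x , y) ∷ xs) with exchange r s x y
    ... | E with go (Exchange.r₁ E) (Exchange.s₁ E) xs
    ...   | L , r₂⊑r₁ , s₂⊑s₁ = record
      { improves = ⇝-++ʳ xs (Exchange.improves E) ⨾ ↭⇒⇝ (↭.swap _ _ ↭-refl)
                   ⨾ ⇝-∷ _ (Least.improves L) ⨾ ↭⇒⇝ (↭.swap _ _ ↭-refl)
      ; least-row = R.trans r₂⊑r₁ (r₁⊑x₁ E) ∷ Least.least-row L
      ; least-col = C.trans s₂⊑s₁ (s₁⊑y₁ E) ∷ Least.least-col L }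
      , R.trans r₂⊑r₁ (r₁⊑r E) , C.trans s₂⊑s₁ (s₁⊑s E)

module ExtremeExtraction {n} {_⊑ᵣ_ _⊑ᶜ_ : Rel (Fin n) 0ℓ}
  (totalᵣ : IsTotalOrder _≡_ _⊑ᵣ_) (totalᶜ : IsTotalOrder _≡_ _⊑ᶜ_)
  {c : Matrix n} (weak : WeakMonge _⊑ᵣ_ _⊑ᶜ_ c) where

  private
    module Min = Extraction totalᵣ totalᶜ weak
    module Max = Extraction (Flip.isTotalOrder totalᵣ) (Flip.isTotalOrder totalᶜ) (λ {i} {k} {j} {l} → WeakMonge-flip {_⊑ᵣ_ = _⊑ᵣ_} {_⊑ᶜ_ = _⊑ᶜ_} {c = c} weak {i} {k} {j} {l})

  record Extremes (xs : List (Edge n)) : Set where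
    field
      {r s r′ s′} : Fin n
      {rest} : List (Edge n)
      improves : xs ⇝[ c ] (r , s) ∷ (r′ , s′) ∷ rest
      least-row : All (r ⊑ᵣ_) (r′ ∷ rows rest)
      least-col : All (s ⊑ᶜ_) (s′ ∷ cols rest)
      greatest-row : All (_⊑ᵣ r′) (rows rest)
      greatest-col : All (_⊑ᶜ s′) (cols rest)

  -- The least corner is taken first and the greatest from what remains. The second extraction may
  -- re-pair the remaining edges, but the lower bounds refer only to rows and columns and carry
  -- over.
  extract-extremes : ∀ e e′ xs → Extremes (e ∷ e′ ∷ xs)
  extract-extremes e e′ xs with Min.extract-least e (e′ ∷ xs)
  ... | record { rest = [] ; improves = imp } = contradiction (↭-length (rows-↭ imp)) λ ()
  ... | record { rest = f ∷ fs ; improves = imp ; least-row = lr ; least-col = lc } with Max.extract-least f fs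
  ...   | M = record
    { improves = imp ⨾ ⇝-∷ _ (Max.Least.improves M)
    ; least-row = All-resp-↭ (rows-↭ (Max.Least.improves M)) lr
    ; least-col = All-resp-↭ (cols-↭ (Max.Least.improves M)) lc
    ; greatest-row = Max.Least.least-row M
    ; greatest-col = Max.Least.least-col M }

-- With equal rows or equal columns, both sides have the same summands.
weaken-Monge : ∀ {n} {c : Matrix n} → Monge c → WeakMonge Fin._≤_ Fin._≤_ c
weaken-Monge {c = c} monge {i} {k} {j} {l} i≤k j≤l with i Fin.≟ k | j Fin.≟ l
... | yes refl | _ = +-comm-≼ _ _
... | no _ | yes refl = ≼-refl
... | no i≢k | no j≢l = ⟨ monge i k j l (Fin.≤∧≢⇒< i≤k i≢k) (Fin.≤∧≢⇒< j≤l j≢l) ⟩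

weaken-AntiMonge : ∀ {n} {c : Matrix n} → AntiMonge c → WeakMonge Fin._≤_ Fin._≥_ c
weaken-AntiMonge {c = c} anti {i} {k} {j} {l} i≤k j≥l with i Fin.≟ k | l Fin.≟ j
... | yes refl | _ = +-comm-≼ _ _
... | no _ | yes refl = ≼-refl
... | no i≢k | no l≢j = ⟨ anti i k l j (Fin.≤∧≢⇒< i≤k i≢k) (Fin.≤∧≢⇒< j≥l l≢j) ⟩

-- Corners shared by both matchings, and absorption of common edges

-- Each of the two least elements occurs in the other list and so is bounded below by the other;
-- antisymmetry gives equality.
least-unique : ∀ {A : Set} {_⊑_ : Rel A 0ℓ} → IsTotalOrder _≡_ _⊑_ → ∀ {x y xs ys} →
               x ∷ xs ↭ y ∷ ys → All (x ⊑_) xs → All (y ⊑_) ys → x ≡ y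
least-unique isTotal x∷xs↭y∷ys x⊑xs y⊑ys = antisym
  (All.head (All-resp-↭ x∷xs↭y∷ys (O.refl ∷ x⊑xs)))
  (All.head (All-resp-↭ (↭-sym x∷xs↭y∷ys) (O.refl ∷ y⊑ys)))
  where
  module O = IsTotalOrder isTotal
  open O using (antisym)

Between : ∀ {n} → Fin n → Fin n → Fin n → Set
Between l u x = l Fin.≤ x × x Fin.≤ u

Enclosed : ∀ {n} (r r′ s s′ : Fin n) → Edge n → Set
Enclosed r r′ s s′ (x , y) = Between r r′ x × Between s s′ y

module _ {n} {r r′ s s′ : Fin n} where

  enclosed : ∀ {xs} → All (Between r r′) (rows xs) → All (Between s s′) (cols xs) → All (Enclosed r r′ s s′) xs
  enclosed bounds-row bounds-col = All.zip (All.map⁻ bounds-row , All.map⁻ bounds-col)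

  enclosed-rows : ∀ {xs} → All (Enclosed r r′ s s′) xs → All (Between r r′) (rows xs)
  enclosed-rows = All.map⁺ ∘ All.map proj₁

  enclosed-cols : ∀ {xs} → All (Enclosed r r′ s s′) xs → All (Between s s′) (cols xs)
  enclosed-cols = All.map⁺ ∘ All.map proj₂

  -- A box constrains rows and columns separately, so only the two multisets preserved by `⇝`
  -- matter, not the pairing.
  enclosed-⇝ : ∀ {c xs ys} → xs ⇝[ c ] ys → All (Enclosed r r′ s s′) xs → All (Enclosed r r′ s s′) ys
  enclosed-⇝ p enc = enclosed (All-resp-↭ (rows-↭ p) (enclosed-rows enc)) (All-resp-↭ (cols-↭ p) (enclosed-cols enc))

  enclosed-⇜ : ∀ {c xs ys} → xs ⇝[ c ] ys → All (Enclosed r r′ s s′) ys → All (Enclosed r r′ s s′) xs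
  enclosed-⇜ p enc = enclosed (All-resp-↭ (↭-sym (rows-↭ p)) (enclosed-rows enc)) (All-resp-↭ (↭-sym (cols-↭ p)) (enclosed-cols enc))

  enclosed-trans : ∀ {r₁ r₁′ s₁ s₁′ e} → Enclosed r₁ r₁′ s₁ s₁′ (r , s) → Enclosed r₁ r₁′ s₁ s₁′ (r′ , s′) →
                   Enclosed r r′ s s′ e → Enclosed r₁ r₁′ s₁ s₁′ e
  enclosed-trans ((r₁≤r , _) , (s₁≤s , _)) ((_ , r′≤r₁′) , (_ , s′≤s₁′)) ((r≤x , x≤r′) , (s≤y , y≤s′)) =
    (Fin.≤-trans r₁≤r r≤x , Fin.≤-trans x≤r′ r′≤r₁′) , (Fin.≤-trans s₁≤s s≤y , Fin.≤-trans y≤s′ s′≤s₁′)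

-- Once the least entries are identified and cancelled, the greatest ones are least for the reversed
-- order. This makes the extractions for `A` and `B` agree on their corners.
extremes-unique : ∀ {n} {l u l′ u′ : Fin n} {xs ys} → l ∷ u ∷ xs ↭ l′ ∷ u′ ∷ ys →
                  All (l Fin.≤_) (u ∷ xs) → All (Fin._≤ u) xs →
                  All (l′ Fin.≤_) (u′ ∷ ys) → All (Fin._≤ u′) ys →
                  l ≡ l′ × u ≡ u′ × xs ↭ ys
extremes-unique p l≤ ≤u l′≤ ≤u′ with refl ← least-unique Fin.≤-isTotalOrder p l≤ l′≤
  with refl ← least-unique (Flip.isTotalOrder Fin.≤-isTotalOrder) (drop-∷ p) ≤u ≤u′ = refl , refl , drop-∷ (drop-∷ p)

between : ∀ {n} {l u : Fin n} {xs} → All (l Fin.≤_) (u ∷ xs) → All (Fin._≤ u) xs → All (Between l u) (l ∷ u ∷ xs)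
between (l≤u ∷ l≤xs) xs≤u = (Fin.≤-refl , l≤u) ∷ (l≤u , Fin.≤-refl) ∷ All.zip (l≤xs , xs≤u)

module Nesting {n} {A B : Matrix n} (monge : Monge A) (anti : AntiMonge B) where

  private
    ≥-isTotalOrder : IsTotalOrder {A = Fin n} _≡_ Fin._≥_
    ≥-isTotalOrder = Flip.isTotalOrder Fin.≤-isTotalOrder

    module EA = ExtremeExtraction Fin.≤-isTotalOrder Fin.≤-isTotalOrder {A} (λ {i} {k} {j} {l} → weaken-Monge monge {i} {k} {j} {l})
    module EB = ExtremeExtraction Fin.≤-isTotalOrder ≥-isTotalOrder {B} (λ {i} {k} {j} {l} → weaken-AntiMonge anti {i} {k} {j} {l})

  -- `A` pairs the extremes in parallel and `B` crosses them. The agreement of the two remainders in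
  -- rows and columns allows the extraction to be repeated.
  record Corners (xs ys : List (Edge n)) : Set where
    field
      {r r′ s s′} : Fin n
      {xs′ ys′} : List (Edge n)
      improvesᴬ : xs ⇝[ A ] (r , s) ∷ (r′ , s′) ∷ xs′
      improvesᴮ : ys ⇝[ B ] (r , s′) ∷ (r′ , s) ∷ ys′
      rows-↭′ : rows xs′ ↭ rows ys′
      cols-↭′ : cols xs′ ↭ cols ys′
      encloses : All (Enclosed r r′ s s′) xs

  private
    pair : ∀ {xs ys r r′ s s′ t t′ u u′ xs′ ys′} →
           xs ⇝[ A ] (r , s) ∷ (r′ , s′) ∷ xs′ → ys ⇝[ B ] (t , u′) ∷ (t′ , u) ∷ ys′ →
           r ≡ t × r′ ≡ t′ × rows xs′ ↭ rows ys′ → s ≡ u × s′ ≡ u′ × cols xs′ ↭ cols ys′ →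
           All (Enclosed r r′ s s′) xs → Corners xs ys
    pair impᴬ impᴮ (refl , refl , p) (refl , refl , q) enc = record
      { improvesᴬ = impᴬ ; improvesᴮ = impᴮ ; rows-↭′ = p ; cols-↭′ = q ; encloses = enc }

    pair-extremes : ∀ {xs ys} → rows xs ↭ rows ys → cols xs ↭ cols ys → EA.Extremes xs → EB.Extremes ys → Corners xs ys
    pair-extremes rows↭ cols↭ a b = pair a.improves b.improves
      (extremes-unique (↭-trans (↭-sym (rows-↭ a.improves)) (↭-trans rows↭ (rows-↭ b.improves)))
        a.least-row a.greatest-row b.least-row b.greatest-row)
      -- For `B` the column order is reversed: its first edge carries the greatest column, so the
      -- two leading columns are swapped and the lower and upper bounds trade places.
      (extremes-unique (↭-trans (↭-sym (cols-↭ a.improves)) (↭-trans cols↭ (↭-trans (cols-↭ b.improves) (↭.swap _ _ ↭-refl))))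
        a.least-col a.greatest-col (All.head b.least-col ∷ b.greatest-col) (All.tail b.least-col))
      (enclosed-⇜ a.improves (enclosed (between a.least-row a.greatest-row) (between a.least-col a.greatest-col)))
      where
      module a = EA.Extremes a
      module b = EB.Extremes b

  extract-corners : ∀ {xs ys} → 2 ≤ℕ length xs → rows xs ↭ rows ys → cols xs ↭ cols ys → Corners xs ys
  extract-corners {_ ∷ []} (ℕ.s≤s ())
  extract-corners {_ ∷ _ ∷ _} {[]} _ rows↭ _ = contradiction (↭-length rows↭) λ ()
  extract-corners {_ ∷ _ ∷ _} {_ ∷ []} _ rows↭ _ = contradiction (↭-length rows↭) λ ()
  extract-corners {e ∷ e′ ∷ xs} {f ∷ f′ ∷ ys} _ rows↭ cols↭ =
    pair-extremes rows↭ cols↭ (EA.extract-extremes e e′ xs) (EB.extract-extremes f f′ ys)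

  -- Sorting the three edges (r , s), (r′ , s′), e for A and the three edges
  -- (r , s′), (r′ , s), e for B produces the same middle edge, so the number of
  -- common edges is kept.
  record Inserted (r r′ s s′ : Fin n) (e : Edge n) : Set where
    field
      {r₁ r₁′ s₁ s₁′} : Fin n
      {e₁} : Edge n
      improvesᴬ : (r , s) ∷ (r′ , s′) ∷ e ∷ [] ⇝[ A ] (r₁ , s₁) ∷ (r₁′ , s₁′) ∷ e₁ ∷ []
      improvesᴮ : (r , s′) ∷ (r′ , s) ∷ e ∷ [] ⇝[ B ] (r₁ , s₁′) ∷ (r₁′ , s₁) ∷ e₁ ∷ []
      encloses : All (Enclosed r₁ r₁′ s₁ s₁′) ((r , s) ∷ (r′ , s′) ∷ e ∷ [])

  insert : ∀ r r′ s s′ e → Inserted r r′ s s′ e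
  insert r r′ s s′ e =
    middle C.improvesᴬ C.improvesᴮ C.rows-↭′ C.cols-↭′ C.encloses
    where
    module C = Corners (extract-corners {(r , s) ∷ (r′ , s′) ∷ e ∷ []} {(r , s′) ∷ (r′ , s) ∷ e ∷ []}
                         (ℕ.s≤s (ℕ.s≤s ℕ.z≤n)) ↭-refl (↭.swap _ _ ↭-refl))

    middle : ∀ {r₁ r₁′ s₁ s₁′ xs ys} →
             (r , s) ∷ (r′ , s′) ∷ e ∷ [] ⇝[ A ] (r₁ , s₁) ∷ (r₁′ , s₁′) ∷ xs →
             (r , s′) ∷ (r′ , s) ∷ e ∷ [] ⇝[ B ] (r₁ , s₁′) ∷ (r₁′ , s₁) ∷ ys →
             rows xs ↭ rows ys → cols xs ↭ cols ys →
             All (Enclosed r₁ r₁′ s₁ s₁′) ((r , s) ∷ (r′ , s′) ∷ e ∷ []) → Inserted r r′ s s′ e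
    middle {xs = []} impᴬ _ _ _ _ = contradiction (↭-length (rows-↭ impᴬ)) λ ()
    middle {xs = _ ∷ _ ∷ _} impᴬ _ _ _ _ = contradiction (↭-length (rows-↭ impᴬ)) λ ()
    middle {xs = _ ∷ []} {[]} _ _ p _ _ = contradiction (↭-length p) λ ()
    middle {xs = _ ∷ []} {_ ∷ _ ∷ _} _ _ p _ _ = contradiction (↭-length p) λ ()
    -- One edge is left on each side, and a single row and a single column determine it, so the two
    -- coincide.
    middle {xs = _ ∷ []} {_ ∷ []} impᴬ impᴮ p q enc with ↭-singleton-inv p | ↭-singleton-inv q
    ... | refl | refl = record { improvesᴬ = impᴬ ; improvesᴮ = impᴮ ; encloses = enc }

  -- Here `zs` holds common edges. The same `zs′` appears in both improvements and has the same
  -- length, so the number of common edges is kept.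
  record Absorbed (r r′ s s′ : Fin n) (zs : List (Edge n)) : Set where
    field
      {r₁ r₁′ s₁ s₁′} : Fin n
      {zs′} : List (Edge n)
      length-≡ : length zs′ ≡ length zs
      improvesᴬ : (r , s) ∷ (r′ , s′) ∷ zs ⇝[ A ] (r₁ , s₁) ∷ (r₁′ , s₁′) ∷ zs′
      improvesᴮ : (r , s′) ∷ (r′ , s) ∷ zs ⇝[ B ] (r₁ , s₁′) ∷ (r₁′ , s₁) ∷ zs′
      encloses : All (Enclosed r₁ r₁′ s₁ s₁′) ((r , s) ∷ (r′ , s′) ∷ zs)

  corners-ordered : ∀ {c : Matrix n} {xs zs r r′ s s′} → xs ⇝[ c ] (r , s) ∷ (r′ , s′) ∷ zs →
                    All (Enclosed r r′ s s′) xs → r Fin.≤ r′ × s Fin.≤ s′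
  corners-ordered imp enc with enclosed-⇝ imp enc
  ... | ((_ , r≤r′) , (_ , s≤s′)) ∷ _ = r≤r′ , s≤s′

  widen : ∀ {r r′ s s′ : Fin n} {r₁ r₁′ s₁ s₁′ xs zs} →
          All (Enclosed r₁ r₁′ s₁ s₁′) ((r , s) ∷ (r′ , s′) ∷ zs) → All (Enclosed r r′ s s′) xs →
          All (Enclosed r₁ r₁′ s₁ s₁′) (xs ++ zs)
  widen (enc₁ ∷ enc₂ ∷ enc-zs) enc = All.++⁺ (All.map (enclosed-trans enc₁ enc₂) enc) enc-zs

  past-two : ∀ {f g : Edge n} h hs → h ∷ f ∷ g ∷ hs ↭ f ∷ g ∷ h ∷ hs
  past-two {f} {g} h hs = ↭-sym (shift h (f ∷ g ∷ []) hs)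

  absorb-∷ : ∀ {r r′ s s′ e zs} → (I : Inserted r r′ s s′ e) → let module I = Inserted I in
             Absorbed I.r₁ I.r₁′ I.s₁ I.s₁′ zs → Absorbed r r′ s s′ (e ∷ zs)
  absorb-∷ {zs = zs} I R = record
    { length-≡ = cong suc R.length-≡
    -- The middle edge `e₁` is set aside while the new corners absorb `zs`.
    ; improvesᴬ = ⇝-++ʳ zs I.improvesᴬ ⨾ ↭⇒⇝ (↭-sym (past-two I.e₁ zs)) ⨾ ⇝-∷ I.e₁ R.improvesᴬ ⨾ ↭⇒⇝ (past-two I.e₁ R.zs′)
    ; improvesᴮ = ⇝-++ʳ zs I.improvesᴮ ⨾ ↭⇒⇝ (↭-sym (past-two I.e₁ zs)) ⨾ ⇝-∷ I.e₁ R.improvesᴮ ⨾ ↭⇒⇝ (past-two I.e₁ R.zs′)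
    ; encloses = widen R.encloses I.encloses }
    where
    module I = Inserted I
    module R = Absorbed R

  -- Each common edge in turn may push the corners outwards; when none remains, the order of the
  -- corners places them in their own box.
  absorb : ∀ {r r′ s s′} → r Fin.≤ r′ → s Fin.≤ s′ → ∀ zs → Absorbed r r′ s s′ zs
  absorb r≤r′ s≤s′ [] = record
    { length-≡ = refl ; improvesᴬ = ⇝-refl ; improvesᴮ = ⇝-refl
    ; encloses = ((Fin.≤-refl , r≤r′) , (Fin.≤-refl , s≤s′)) ∷ ((r≤r′ , Fin.≤-refl) , (s≤s′ , Fin.≤-refl)) ∷ [] }
  absorb {r} {r′} {s} {s′} _ _ (e ∷ zs) = continue (insert r r′ s s′ e)
    where
    continue : Inserted r r′ s s′ e → Absorbed r r′ s s′ (e ∷ zs)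
    continue I with corners-ordered (Inserted.improvesᴬ I) (Inserted.encloses I)
    ... | r₁≤r₁′ , s₁≤s₁′ = absorb-∷ I (absorb r₁≤r₁′ s₁≤s₁′ zs)

  -- `zs` lists the common edges and `xs`, `ys` the others. Enclosure of all remaining edges, common
  -- ones included, is what later pins the corners to a definite layer.
  record Layer (zs xs ys : List (Edge n)) : Set where
    field
      {r r′ s s′} : Fin n
      {zs′ xs′ ys′} : List (Edge n)
      length-≡ : length zs′ ≡ length zs
      improvesᴬ : zs ++ xs ⇝[ A ] (r , s) ∷ (r′ , s′) ∷ zs′ ++ xs′
      improvesᴮ : zs ++ ys ⇝[ B ] (r , s′) ∷ (r′ , s) ∷ zs′ ++ ys′
      rows-↭′ : rows xs′ ↭ rows ys′
      cols-↭′ : cols xs′ ↭ cols ys′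
      encloses : All (Enclosed r r′ s s′) ((r , s) ∷ (r′ , s′) ∷ zs′ ++ xs′)

  absorbed-layer : ∀ {zs xs ys} → (C : Corners xs ys) → let module C = Corners C in
                   Absorbed C.r C.r′ C.s C.s′ zs → Layer zs xs ys
  absorbed-layer {zs} {xs} {ys} C R = record
    { length-≡ = R.length-≡
    ; improvesᴬ = imp
    ; improvesᴮ = ↭⇒⇝ (++-comm zs ys) ⨾ ⇝-++ʳ zs C.improvesᴮ ⨾ ↭⇒⇝ (++⁺ˡ (_ ∷ _ ∷ []) (++-comm C.ys′ zs)) ⨾ ⇝-++ʳ C.ys′ R.improvesᴮ
    ; rows-↭′ = C.rows-↭′
    ; cols-↭′ = C.cols-↭′
    ; encloses = enclosed-⇝ (↭⇒⇝ (++-comm xs zs) ⨾ imp) (widen R.encloses C.encloses) }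
    where
    module C = Corners C
    module R = Absorbed R

    imp : zs ++ xs ⇝[ A ] (R.r₁ , R.s₁) ∷ (R.r₁′ , R.s₁′) ∷ R.zs′ ++ C.xs′
    -- The corners come from the non-common edges; the common edges are then moved next to them for
    -- absorption.
    imp = ↭⇒⇝ (++-comm zs xs) ⨾ ⇝-++ʳ zs C.improvesᴬ ⨾ ↭⇒⇝ (++⁺ˡ (_ ∷ _ ∷ []) (++-comm C.xs′ zs)) ⨾ ⇝-++ʳ C.xs′ R.improvesᴬ

  extract-layer : ∀ zs {xs ys} → 2 ≤ℕ length xs → rows xs ↭ rows ys → cols xs ↭ cols ys → Layer zs xs ys
  extract-layer zs {xs} {ys} 2≤ rows↭ cols↭ = continue (extract-corners 2≤ rows↭ cols↭)
    where
    continue : Corners xs ys → Layer zs xs ys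
    continue C with corners-ordered (Corners.improvesᴬ C) (Corners.encloses C)
    ... | r≤r′ , s≤s′ = absorbed-layer C (absorb r≤r′ s≤s′ zs)

unique-↭ : ∀ {E : Set} {xs ys : List E} → Unique xs → Unique ys →
           (∀ {x} → x ∈ₗ xs → x ∈ₗ ys) → (∀ {x} → x ∈ₗ ys → x ∈ₗ xs) → xs ↭ ys
unique-↭ xs! ys! xs⊆ys ys⊆xs = ∼bag⇒↭ (unique∧set⇒bag xs! ys! (mk⇔ xs⊆ys ys⊆xs))

-- Inner and outer layers

toℕ-opposite : ∀ {n} (i : Fin n) → suc (toℕ i ℕ.+ toℕ (opposite i)) ≡ n
toℕ-opposite {n} i = ≡.trans (cong (λ x → suc (toℕ i) ℕ.+ x) (Fin.opposite-prop i)) (ℕ.m+[n∸m]≡n (Fin.toℕ<n i))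

-- Equivalent to Middle t, but free of truncated subtraction and visibly
-- symmetric under opposite.
Inner : ∀ {n} → ℕ → Fin n → Set
Inner t i = t ≤ℕ toℕ i × t ≤ℕ toℕ (opposite i)

inner? : ∀ {n} t (i : Fin n) → Dec (Inner t i)
inner? t i = (t ℕ.≤? toℕ i) ×-dec (t ℕ.≤? toℕ (opposite i))

inner outer : ∀ {n} → ℕ → List (Fin n)
inner t = filter (inner? t) (allFin _)
outer t = filter (¬? ∘ inner? t) (allFin _)

inner! : ∀ {n} t → Unique (inner {n} t)
inner! t = Unique.filter⁺ (inner? t) (Unique.allFin⁺ _)

outer! : ∀ {n} t → Unique (outer {n} t)
outer! t = Unique.filter⁺ (¬? ∘ inner? t) (Unique.allFin⁺ _)

module _ {n t : ℕ} {i : Fin n} where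

  ∈-inner⁺ : Inner t i → i ∈ₗ inner t
  ∈-inner⁺ = ∈-filter⁺ (inner? t) (∈-allFin i)

  ∈-inner⁻ : i ∈ₗ inner t → Inner t i
  ∈-inner⁻ i∈ = proj₂ (∈-filter⁻ (inner? t) {xs = allFin n} i∈)

  ∈-outer⁺ : ¬ Inner t i → i ∈ₗ outer t
  ∈-outer⁺ = ∈-filter⁺ (¬? ∘ inner? t) (∈-allFin i)

  ∈-outer⁻ : i ∈ₗ outer t → ¬ Inner t i
  ∈-outer⁻ i∈ = proj₂ (∈-filter⁻ (¬? ∘ inner? t) {xs = allFin n} i∈)

opposite-Inner : ∀ {n t} {i : Fin n} → Inner t i → Inner t (opposite i)
opposite-Inner {t = t} {i} (t≤i , t≤i′) = t≤i′ , subst (t ≤ℕ_) (cong toℕ (≡.sym (Fin.opposite-involutive i))) t≤i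

inner++outer : ∀ {n} t → outer t ++ inner t ↭ allFin n
inner++outer {n} t = unique-↭
  (Unique.++⁺ (outer! t) (inner! t) (λ (∈o , ∈i) → ∈-outer⁻ {t = t} ∈o (∈-inner⁻ ∈i)))
  (Unique.allFin⁺ n) (λ _ → ∈-allFin _) (λ {i} _ → cover i)
  where
  cover : ∀ i → i ∈ₗ outer t ++ inner t
  cover i with inner? t i
  ... | yes p = ∈-++⁺ʳ (outer t) (∈-inner⁺ p)
  ... | no ¬p = ∈-++⁺ˡ (∈-outer⁺ {t = t} ¬p)

opposite-outer : ∀ {n} t → map opposite (outer t) ↭ outer {n} t
opposite-outer t = unique-↭
  (Unique.map⁺ (λ {i} {j} eq → ≡.trans (≡.sym (Fin.opposite-involutive i)) (≡.trans (cong opposite eq) (Fin.opposite-involutive j))) (outer! t))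
  (outer! t) to from
  where
  to : ∀ {i} → i ∈ₗ map opposite (outer t) → i ∈ₗ outer t
  to i∈ with ∈-map⁻ opposite i∈
  ... | j , j∈ , refl = ∈-outer⁺ {t = t} λ inn →
    ∈-outer⁻ {t = t} j∈ (subst (Inner t) (Fin.opposite-involutive j) (opposite-Inner inn))
  from : ∀ {i} → i ∈ₗ outer t → i ∈ₗ map opposite (outer t)
  from {i} i∈ = subst (_∈ₗ map opposite (outer t)) (Fin.opposite-involutive i)
    (∈-map⁺ opposite (∈-outer⁺ {t = t} λ inn → ∈-outer⁻ {t = t} i∈
      (subst (Inner t) (Fin.opposite-involutive i) (opposite-Inner inn))))

-- A fixed point satisfies `2i + 1 = n`. If `i < t`, then `2i + 2 ≤ 2t ≤ n`, a contradiction; so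
-- `t ≤ i`, and `i = opposite i` makes the index inner. This keeps diagonal and antidiagonal outer
-- edges apart.
opposite≢ : ∀ {n t} {i : Fin n} → t ℕ.+ t ≤ℕ n → ¬ Inner t i → i ≢ opposite i
opposite≢ {n} {t} {i} 2t≤n ¬inner i≡ = ¬inner (t≤i , subst (t ≤ℕ_) (cong toℕ i≡) t≤i)
  where
  1+i+i≡n : suc (toℕ i ℕ.+ toℕ i) ≡ n
  1+i+i≡n = ≡.trans (cong (λ x → suc (toℕ i ℕ.+ toℕ x)) i≡) (toℕ-opposite i)
  t≤i : t ≤ℕ toℕ i
  t≤i with t ℕ.≤? toℕ i
  ... | yes p = p
  ... | no t≰i = contradiction 2t≤n (ℕ.<⇒≱ (subst (ℕ._< t ℕ.+ t) 1+i+i≡n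
    (ℕ.≤-trans (ℕ.≤-reflexive (cong suc (≡.sym (ℕ.+-suc _ _)))) (ℕ.+-mono-≤ (ℕ.≰⇒> t≰i) (ℕ.≰⇒> t≰i)))))

module _ {n t : ℕ} (2t+2≤n : suc t ℕ.+ suc t ≤ℕ n) where

  -- The 0-based index `t`, inner at depth `t` but not at depth `suc t`; the bound on `n` leaves
  -- room for its distinct opposite.
  layer : Fin n
  layer = fromℕ< (ℕ.≤-trans (ℕ.m≤m+n (suc t) (suc t)) 2t+2≤n)

  private
    toℕ-layer : toℕ layer ≡ t
    toℕ-layer = Fin.toℕ-fromℕ< _

    layer+opposite : suc (t ℕ.+ toℕ (opposite layer)) ≡ n
    layer+opposite = ≡.trans (cong (λ x → suc (x ℕ.+ toℕ (opposite layer))) (≡.sym toℕ-layer)) (toℕ-opposite layer)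

  layer-Inner : Inner t layer
  layer-Inner = ℕ.≤-reflexive (≡.sym toℕ-layer) ,
    ℕ.<⇒≤ (ℕ.+-cancelˡ-≤ (suc t) _ _ (ℕ.≤-trans 2t+2≤n (ℕ.≤-reflexive (≡.sym layer+opposite))))

  layer-¬Inner : ¬ Inner (suc t) layer
  layer-¬Inner (t<layer , _) = ℕ.<-irrefl (≡.sym toℕ-layer) t<layer

  opposite-layer-¬Inner : ¬ Inner (suc t) (opposite layer)
  opposite-layer-¬Inner inn = layer-¬Inner (subst (Inner (suc t)) (Fin.opposite-involutive layer) (opposite-Inner inn))

  layer-bounds : ∀ {i} → Inner t i → Between layer (opposite layer) i
  layer-bounds {i} (t≤i , t≤i′) = subst (_≤ℕ toℕ i) (≡.sym toℕ-layer) t≤i ,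
    ℕ.+-cancelˡ-≤ t _ _ (ℕ.≤-trans (ℕ.≤-reflexive (ℕ.+-comm t (toℕ i))) (ℕ.≤-trans (ℕ.+-monoʳ-≤ (toℕ i) t≤i′)
      (ℕ.≤-reflexive (ℕ.suc-injective (≡.trans (toℕ-opposite i) (≡.sym layer+opposite))))))

  Inner-suc : ∀ {i} → Inner t i → i ≢ layer → i ≢ opposite layer → Inner (suc t) i
  Inner-suc {i} (t≤i , t≤i′) i≢ i≢′ =
    ℕ.≤∧≢⇒< t≤i (λ t≡i → i≢ (Fin.toℕ-injective (≡.trans (≡.sym t≡i) (≡.sym toℕ-layer)))) ,
    ℕ.≤∧≢⇒< t≤i′ (λ t≡i′ → i≢′ (≡.trans (≡.sym (Fin.opposite-involutive i))
      (cong opposite (Fin.toℕ-injective (≡.trans (≡.sym t≡i′) (≡.sym toℕ-layer))))))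

  Inner-pred : ∀ {i : Fin n} → Inner (suc t) i → Inner t i
  Inner-pred (t<i , t<i′) = ℕ.<⇒≤ t<i , ℕ.<⇒≤ t<i′

  layer≢opposite : layer ≢ opposite layer
  layer≢opposite = opposite≢ 2t+2≤n layer-¬Inner

  inner-suc : inner t ↭ layer ∷ opposite layer ∷ inner (suc t)
  inner-suc = unique-↭ (inner! t)
    ((layer≢opposite ∷ avoid layer-¬Inner) ∷ avoid opposite-layer-¬Inner ∷ inner! (suc t)) to from
    where
    avoid : ∀ {j} → ¬ Inner (suc t) j → All (j ≢_) (inner (suc t))
    avoid ¬inn = All.tabulate λ i∈ j≡i → ¬inn (subst (Inner (suc t)) (≡.sym j≡i) (∈-inner⁻ i∈))
    to : ∀ {i} → i ∈ₗ inner t → i ∈ₗ layer ∷ opposite layer ∷ inner (suc t)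
    to {i} i∈ with i Fin.≟ layer | i Fin.≟ opposite layer
    ... | yes eq | _ = here eq
    ... | no _ | yes eq = there (here eq)
    ... | no i≢ | no i≢′ = there (there (∈-inner⁺ (Inner-suc (∈-inner⁻ i∈) i≢ i≢′)))
    from : ∀ {i} → i ∈ₗ layer ∷ opposite layer ∷ inner (suc t) → i ∈ₗ inner t
    from (here refl) = ∈-inner⁺ layer-Inner
    from (there (here refl)) = ∈-inner⁺ (opposite-Inner layer-Inner)
    from (there (there i∈)) = ∈-inner⁺ (Inner-pred (∈-inner⁻ i∈))

  -- Each `outer` list complements its `inner` list in `allFin n`, so after `inner-suc` the shared
  -- part `inner (suc t)` cancels.
  outer-suc : outer (suc t) ↭ layer ∷ opposite layer ∷ outer t
  outer-suc = drop-++ʳ (inner (suc t)) (↭-trans (inner++outer (suc t)) (↭-trans (↭-sym (inner++outer t))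
    (↭-trans (++⁺ˡ (outer t) inner-suc) (shifts (outer t) (layer ∷ opposite layer ∷ [])))))
    where
    drop-++ʳ : ∀ {xs ys : List (Fin n)} zs → xs ++ zs ↭ ys ++ zs → xs ↭ ys
    drop-++ʳ {xs} {ys} [] p = ↭-trans (↭-sym (++-identityʳ xs)) (↭-trans p (++-identityʳ ys))
    drop-++ʳ {xs} {ys} (z ∷ zs) p = drop-++ʳ zs (drop-mid xs ys p)

inner-zero : ∀ {n} → inner 0 ↭ allFin n
inner-zero = unique-↭ (inner! 0) (Unique.allFin⁺ _) (λ _ → ∈-allFin _) (λ _ → ∈-inner⁺ (ℕ.z≤n , ℕ.z≤n))

outer-zero : ∀ {n} → outer {n} 0 ↭ []
outer-zero {n} = ↭-reflexive (filter-none (¬? ∘ inner? 0) (All.tabulate {xs = allFin n} λ _ ¬inn → ¬inn (ℕ.z≤n , ℕ.z≤n)))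

length-inner : ∀ {n} t → t ℕ.+ t ≤ℕ n → t ℕ.+ t ℕ.+ length (inner {n} t) ≡ n
length-inner {n} zero _ = ≡.trans (↭-length (inner-zero {n})) (List.length-tabulate id)
length-inner {n} (suc t) 2t+2≤n = begin
  suc t ℕ.+ suc t ℕ.+ length (inner {n} (suc t))         ≡⟨ cong (λ x → suc x ℕ.+ length (inner {n} (suc t))) (ℕ.+-suc t t) ⟩
  suc (suc (t ℕ.+ t ℕ.+ length (inner {n} (suc t))))     ≡⟨ ≡.trans (ℕ.+-suc (t ℕ.+ t) _) (cong suc (ℕ.+-suc (t ℕ.+ t) _)) ⟨
  t ℕ.+ t ℕ.+ suc (suc (length (inner {n} (suc t))))     ≡⟨ cong (t ℕ.+ t ℕ.+_) (↭-length (inner-suc {n} 2t+2≤n)) ⟨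
  t ℕ.+ t ℕ.+ length (inner {n} t)                       ≡⟨ length-inner t (ℕ.≤-trans (ℕ.+-mono-≤ (ℕ.n≤1+n t) (ℕ.n≤1+n t)) 2t+2≤n) ⟩
  n                                                      ∎
  where open ≡.≡-Reasoning

-- Peeling layers off both matchings

between-unique : ∀ {n} {l u l′ u′ : Fin n} {xs ys} → l ∷ u ∷ xs ↭ l′ ∷ u′ ∷ ys →
                 All (Between l u) (l ∷ u ∷ xs) → All (Between l′ u′) (l′ ∷ u′ ∷ ys) →
                 l ≡ l′ × u ≡ u′ × xs ↭ ys
between-unique p (_ ∷ u∈ ∷ xs∈) (_ ∷ u′∈ ∷ ys∈) =
  extremes-unique p (All.map proj₁ (u∈ ∷ xs∈)) (All.map proj₂ xs∈) (All.map proj₁ (u′∈ ∷ ys∈)) (All.map proj₂ ys∈)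

diagonal antidiagonal : ∀ {n} → Fin n → Edge n
diagonal i = i , i
antidiagonal i = i , opposite i

module Peeling {n} {A B : Matrix n} (monge : Monge A) (anti : AntiMonge B) where

  open Nesting {A = A} {B = B} monge anti using (Layer; extract-layer)

  -- The outer t layers have the required form; k common edges and, in each
  -- matching, ℓ further edges remain.
  record Peeled (xs₀ ys₀ : List (Edge n)) (k ℓ t : ℕ) : Set where
    field
      {common restᴬ restᴮ} : List (Edge n)
      length-common : length common ≡ k
      length-restᴬ : length restᴬ ≡ ℓ
      improvesᴬ : xs₀ ⇝[ A ] map diagonal (outer t) ++ common ++ restᴬ
      improvesᴮ : ys₀ ⇝[ B ] map antidiagonal (outer t) ++ common ++ restᴮ
      rows-↭′ : rows restᴬ ↭ rows restᴮ
      cols-↭′ : cols restᴬ ↭ cols restᴮ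
      rows-inner : rows (common ++ restᴬ) ↭ inner t
      cols-inner : cols (common ++ restᴬ) ↭ inner t

  module _ {t : ℕ} (2t+2≤n : suc t ℕ.+ suc t ≤ℕ n) where

    private
      p q : Fin n
      p = layer 2t+2≤n
      q = opposite p

      inner-bounds : All (Between p q) (p ∷ q ∷ inner (suc t))
      inner-bounds = All-resp-↭ (inner-suc 2t+2≤n) (All.tabulate λ i∈ → layer-bounds 2t+2≤n (∈-inner⁻ {t = t} i∈))

    diagonal-layer : ∀ zs → map diagonal (outer t) ++ (p , p) ∷ (q , q) ∷ zs ↭ map diagonal (outer (suc t)) ++ zs
    diagonal-layer zs = ↭-trans (shifts (map diagonal (outer t)) (_ ∷ _ ∷ []))
      (++⁺ʳ zs (map⁺ diagonal (↭-sym (outer-suc 2t+2≤n))))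

    antidiagonal-layer : ∀ zs → map antidiagonal (outer t) ++ (p , q) ∷ (q , p) ∷ zs ↭ map antidiagonal (outer (suc t)) ++ zs
    antidiagonal-layer zs = ↭-trans
      -- Since `p` is the opposite of `q`, the edge `(q , p)` is `antidiagonal q`.
      (↭-reflexive (cong (λ j → map antidiagonal (outer t) ++ (p , q) ∷ (q , j) ∷ zs) (≡.sym (Fin.opposite-involutive p))))
      (↭-trans (shifts (map antidiagonal (outer t)) (_ ∷ _ ∷ []))
        (++⁺ʳ zs (map⁺ antidiagonal (↭-sym (outer-suc 2t+2≤n)))))

    -- The remaining rows are those of `inner t`, with extremes `p` and `q`. The corners of the
    -- layer enclose the same rows, so uniqueness of extremes forces them to be `p` and `q`;
    -- likewise for columns.
    peel-layer : ∀ {xs₀ ys₀ k ℓ} (P : Peeled xs₀ ys₀ k (suc (suc ℓ)) t) → let module P = Peeled P in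
                 Layer P.common P.restᴬ P.restᴮ → Peeled xs₀ ys₀ k ℓ (suc t)
    peel-layer {xs₀} {ys₀} {k} {ℓ} P L = replace
      (between-unique (↭-trans (↭-sym (rows-↭ L.improvesᴬ)) (↭-trans P.rows-inner (inner-suc 2t+2≤n)))
        (enclosed-rows L.encloses) inner-bounds)
      (between-unique (↭-trans (↭-sym (cols-↭ L.improvesᴬ)) (↭-trans P.cols-inner (inner-suc 2t+2≤n)))
        (enclosed-cols L.encloses) inner-bounds)
      L.improvesᴬ L.improvesᴮ
      where
      module P = Peeled P
      module L = Layer L

      length-restᴬ′ : length L.xs′ ≡ ℓ
      -- Rows are counted before and after the extraction: two corners leave, and the number of
      -- common edges stays `k`.
      length-restᴬ′ = ℕ.+-cancelˡ-≡ (2 ℕ.+ k) _ _ (begin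
        2 ℕ.+ k ℕ.+ length L.xs′                        ≡⟨ cong (λ x → 2 ℕ.+ x ℕ.+ length L.xs′) (≡.trans L.length-≡ P.length-common) ⟨
        2 ℕ.+ (length L.zs′ ℕ.+ length L.xs′)           ≡⟨ cong (2 ℕ.+_) (length-++ L.zs′) ⟨
        2 ℕ.+ length (L.zs′ ++ L.xs′)                   ≡⟨ cong (2 ℕ.+_) (length-map proj₁ (L.zs′ ++ L.xs′)) ⟨
        2 ℕ.+ length (rows (L.zs′ ++ L.xs′))            ≡⟨ ↭-length (rows-↭ L.improvesᴬ) ⟨
        length (rows (P.common ++ P.restᴬ))             ≡⟨ length-map proj₁ (P.common ++ P.restᴬ) ⟩
        length (P.common ++ P.restᴬ)                    ≡⟨ length-++ P.common ⟩
        length P.common ℕ.+ length P.restᴬ              ≡⟨ cong₂ ℕ._+_ P.length-common P.length-restᴬ ⟩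
        k ℕ.+ (2 ℕ.+ ℓ)                                 ≡⟨ ≡.trans (ℕ.+-suc k _) (cong suc (ℕ.+-suc k ℓ)) ⟩
        2 ℕ.+ k ℕ.+ ℓ                                   ∎)
        where open ≡.≡-Reasoning

      -- Taking the equalities as arguments over variable corners allows matching them with `refl`,
      -- which turns the corners into `p` and `q`.
      replace : ∀ {r r′ s s′} →
                r ≡ p × r′ ≡ q × rows (L.zs′ ++ L.xs′) ↭ inner (suc t) →
                s ≡ p × s′ ≡ q × cols (L.zs′ ++ L.xs′) ↭ inner (suc t) →
                P.common ++ P.restᴬ ⇝[ A ] (r , s) ∷ (r′ , s′) ∷ L.zs′ ++ L.xs′ →
                P.common ++ P.restᴮ ⇝[ B ] (r , s′) ∷ (r′ , s) ∷ L.zs′ ++ L.ys′ →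
                Peeled xs₀ ys₀ k ℓ (suc t)
      replace (refl , refl , rows↭) (refl , refl , cols↭) impᴬ impᴮ = record
        { length-common = ≡.trans L.length-≡ P.length-common
        ; length-restᴬ = length-restᴬ′
        ; improvesᴬ = P.improvesᴬ ⨾ ⇝-++ˡ (map diagonal (outer t)) impᴬ ⨾ ↭⇒⇝ (diagonal-layer _)
        ; improvesᴮ = P.improvesᴮ ⨾ ⇝-++ˡ (map antidiagonal (outer t)) impᴮ ⨾ ↭⇒⇝ (antidiagonal-layer _)
        ; rows-↭′ = L.rows-↭′
        ; cols-↭′ = L.cols-↭′
        ; rows-inner = rows↭
        ; cols-inner = cols↭ }

  -- Each layer consumes two non-common edges of each matching, which explains the initial count
  -- `t ℕ.+ t ℕ.+ ℓ`.
  peel : ∀ {xs₀ ys₀ k ℓ} t → t ℕ.+ t ≤ℕ n → Peeled xs₀ ys₀ k (t ℕ.+ t ℕ.+ ℓ) 0 → Peeled xs₀ ys₀ k ℓ t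
  peel zero _ P = P
  peel {xs₀} {ys₀} {k} {ℓ} (suc t) 2t+2≤n P₀ = continue
    (peel t (ℕ.≤-trans (ℕ.+-mono-≤ (ℕ.n≤1+n t) (ℕ.n≤1+n t)) 2t+2≤n) (subst (λ x → Peeled xs₀ ys₀ k x 0) length-≡ P₀))
    where
    length-≡ : suc t ℕ.+ suc t ℕ.+ ℓ ≡ t ℕ.+ t ℕ.+ suc (suc ℓ)
    length-≡ = begin
      suc t ℕ.+ suc t ℕ.+ ℓ      ≡⟨ cong (λ x → suc x ℕ.+ ℓ) (ℕ.+-suc t t) ⟩
      suc (suc (t ℕ.+ t ℕ.+ ℓ))  ≡⟨ ≡.trans (ℕ.+-suc (t ℕ.+ t) _) (cong suc (ℕ.+-suc (t ℕ.+ t) ℓ)) ⟨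
      t ℕ.+ t ℕ.+ suc (suc ℓ)    ∎
      where open ≡.≡-Reasoning

    continue : Peeled xs₀ ys₀ k (suc (suc ℓ)) t → Peeled xs₀ ys₀ k ℓ (suc t)
    continue P = peel-layer 2t+2≤n P (extract-layer P.common 2≤ P.rows-↭′ P.cols-↭′)
      where
      module P = Peeled P
      2≤ : 2 ≤ℕ length P.restᴬ
      2≤ = subst (2 ≤ℕ_) (≡.sym P.length-restᴬ) (ℕ.s≤s (ℕ.s≤s ℕ.z≤n))

-- Edge sets and lists of their edges

length-as-sum : ∀ {E : Set} (xs : List E) → ListSum.sum ℕ.+-0-commutativeMonoid (λ _ → 1) xs ≡ length xs
length-as-sum [] = refl
length-as-sum (_ ∷ xs) = cong suc (length-as-sum xs)

∣∣-as-sum : ∀ {n} (s : Subset n) → Subset.∣ s ∣ ≡ foldrᶠ ℕ._+_ 0 (λ j → if lookup s j then 1 else 0)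
∣∣-as-sum [] = refl
∣∣-as-sum (true ∷ s) = cong suc (∣∣-as-sum s)
∣∣-as-sum (false ∷ s) = ∣∣-as-sum s

foldrᶠ-cong : ∀ {n} {f g : Fin n → ℕ} → (∀ i → f i ≡ g i) → foldrᶠ ℕ._+_ 0 f ≡ foldrᶠ ℕ._+_ 0 g
foldrᶠ-cong {zero} _ = refl
foldrᶠ-cong {suc n} f≗g = cong₂ ℕ._+_ (f≗g Fin.zero) (foldrᶠ-cong (f≗g ∘ Fin.suc))

-- Any duplicate-free listing yields the cost and the cardinality, since two listings of one edge
-- set are permutations of each other.
record Lists {n} (M : EdgeSet n) (xs : List (Edge n)) : Set where
  field
    unique : Unique xs
    sound : ∀ {i j} → (i , j) ∈ₗ xs → [u i ,v j ]∈ M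
    complete : ∀ {i j} → [u i ,v j ]∈ M → (i , j) ∈ₗ xs

module _ {n} (M : EdgeSet n) where

  private
    isEdge : Edge n → Bool
    isEdge (i , j) = lookup (M i) j

    pairs : List (Edge n)
    pairs = cartesianProduct (allFin n) (allFin n)

  edges : List (Edge n)
  edges = filter (T? ∘ isEdge) pairs

  lists-edges : Lists M edges
  lists-edges = record
    { unique = Unique.filter⁺ (T? ∘ isEdge) (Unique.cartesianProduct⁺ (Unique.allFin⁺ n) (Unique.allFin⁺ n))
    ; sound = λ {i} {j} e∈ → lookup⇒[]= j (M i) (Equivalence.to T-≡ (proj₂ (∈-filter⁻ (T? ∘ isEdge) {xs = pairs} e∈)))
    ; complete = λ {i} {j} j∈ → ∈-filter⁺ (T? ∘ isEdge) (∈-cartesianProduct⁺ (∈-allFin i) (∈-allFin j))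
        (Equivalence.from T-≡ ([]=⇒lookup j∈)) }

  cost-edges : ∀ (c : Matrix n) → total c edges ≈ cost c M
  cost-edges c = ≈-trans (sum-filter (uncurry c) isEdge pairs)
    (sum-cartesianProduct (λ e → if isEdge e then uncurry c e else 0ℝ) id id)
    where
    ≈-trans = CommutativeMonoid.trans +-0-commutativeMonoid

  length-edges : length edges ≡ ∣ M ∣
  length-edges = begin
    length edges                                                                ≡⟨ length-as-sum edges ⟨
    ℕΣ.sum (λ _ → 1) edges                                                      ≡⟨ ℕΣ.sum-filter (λ _ → 1) isEdge pairs ⟩
    ℕΣ.sum (λ e → if isEdge e then 1 else 0) pairs                              ≡⟨ ℕΣ.sum-cartesianProduct (λ e → if isEdge e then 1 else 0) id id ⟩
    foldrᶠ ℕ._+_ 0 (λ i → foldrᶠ ℕ._+_ 0 (λ j → if isEdge (i , j) then 1 else 0)) ≡⟨ foldrᶠ-cong (∣∣-as-sum ∘ M) ⟨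
    ∣ M ∣                                                                       ∎
    where
    module ℕΣ = ListSum ℕ.+-0-commutativeMonoid
    open ≡.≡-Reasoning

module _ {n} {M : EdgeSet n} {xs} (lists : Lists M xs) where
  private
    module L = Lists lists
    module E = Lists (lists-edges M)

  lists⇒↭ : edges M ↭ xs
  lists⇒↭ = unique-↭ E.unique L.unique (L.complete ∘ E.sound) (E.complete ∘ L.sound)

  cost≈total : ∀ c → cost c M ≈ total c xs
  cost≈total c = ≈.trans (≈.sym (cost-edges M c)) (sum-↭ (uncurry c) lists⇒↭)
    where module ≈ = Poset.Eq ≼-poset

  ∣∣≡length : ∣ M ∣ ≡ length xs
  ∣∣≡length = ≡.trans (≡.sym (length-edges M)) (↭-length lists⇒↭)

fromList : ∀ {n} → List (Edge n) → EdgeSet n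
fromList xs i = Vec.tabulate (λ j → does (_∈?_ (i , j) xs))
  where open DecMembership (≡-dec Fin._≟_ Fin._≟_) using (_∈?_)

lists-fromList : ∀ {n} {xs : List (Edge n)} → Unique xs → Lists (fromList xs) xs
lists-fromList {n} {xs} xs! = record { unique = xs! ; sound = sound ; complete = complete }
  where
  open DecMembership (≡-dec (Fin._≟_ {n}) (Fin._≟_ {n})) using (_∈?_)
  lookup-≡ : ∀ i j → lookup (fromList xs i) j ≡ does ((i , j) ∈? xs)
  lookup-≡ i j = lookup∘tabulate (λ j → does ((i , j) ∈? xs)) j
  sound : ∀ {i j} → (i , j) ∈ₗ xs → [u i ,v j ]∈ fromList xs
  sound {i} {j} e∈ = lookup⇒[]= j (fromList xs i) (≡.trans (lookup-≡ i j) (dec-true ((i , j) ∈? xs) e∈))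
  complete : ∀ {i j} → [u i ,v j ]∈ fromList xs → (i , j) ∈ₗ xs
  complete {i} {j} j∈ with (i , j) ∈? xs | ≡.trans (≡.sym (lookup-≡ i j)) ([]=⇒lookup j∈)
  ... | yes e∈ | _ = e∈
  ... | no _ | ()

module _ {D E : Set} (f : D → E) where

  map-unique⁺ : ∀ {xs} → (∀ {x y} → x ∈ₗ xs → y ∈ₗ xs → f x ≡ f y → x ≡ y) → Unique xs → Unique (map f xs)
  map-unique⁺ {[]} _ _ = []
  map-unique⁺ {x ∷ xs} inj (x∉ ∷ xs!) =
    All.map⁺ (All.tabulate λ y∈ fx≡fy → All.lookup x∉ y∈ (inj (here refl) (there y∈) fx≡fy)) ∷
    map-unique⁺ (λ y∈ z∈ → inj (there y∈) (there z∈)) xs!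

  map-unique⇒injective : ∀ {xs x y} → Unique (map f xs) → x ∈ₗ xs → y ∈ₗ xs → f x ≡ f y → x ≡ y
  map-unique⇒injective _ (here refl) (here refl) _ = refl
  map-unique⇒injective (x∉ ∷ _) (here refl) (there y∈) fx≡fy = contradiction fx≡fy (All.lookup (All.map⁻ x∉) y∈)
  map-unique⇒injective (y∉ ∷ _) (there x∈) (here refl) fx≡fy = contradiction (≡.sym fx≡fy) (All.lookup (All.map⁻ y∉) x∈)
  map-unique⇒injective (_ ∷ xs!) (there x∈) (there y∈) fx≡fy = map-unique⇒injective xs! x∈ y∈ fx≡fy

record Enumerates {n} (S : Pred (Fin n) 0ℓ) (is : List (Fin n)) : Set where
  field
    unique : Unique is
    sound : ∀ {i} → i ∈ₗ is → S i
    complete : ∀ {i} → S i → i ∈ₗ is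

Unique-↭ : ∀ {E : Set} {xs ys : List E} → xs ↭ ys → Unique xs → Unique ys
Unique-↭ xs↭ys = Unique-resp-↭ (≡.setoid _) (↭.↭⇒↭ₛ xs↭ys)

module _ {n} {S T : Pred (Fin n) 0ℓ} {is js} (enumS : Enumerates S is) (enumT : Enumerates T js)
         {M : EdgeSet n} {xs} (lists : Lists M xs) where
  private
    module S = Enumerates enumS
    module T = Enumerates enumT
    module L = Lists lists

  -- Uniqueness of partners makes both projections injective on the edges, so the lists of rows and
  -- columns are free of duplicates and only their members need comparing.
  perfect⇒↭ : IsPerfectMatchingOn S T M → rows xs ↭ is × cols xs ↭ js
  perfect⇒↭ perfect =
    unique-↭ (map-unique⁺ proj₁ (λ { x∈ y∈ refl → same-row x∈ y∈ }) L.unique) S.unique row⁺ row⁻ ,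
    unique-↭ (map-unique⁺ proj₂ (λ { x∈ y∈ refl → same-col x∈ y∈ }) L.unique) T.unique col⁺ col⁻
    where
    open IsPerfectMatchingOn perfect
    same-row : ∀ {i j j′} → (i , j) ∈ₗ xs → (i , j′) ∈ₗ xs → (i , j) ≡ (i , j′)
    same-row x∈ y∈ with coversU (proj₁ (inside (L.sound x∈)))
    ... | _ , _ , unique = cong (_ ,_) (≡.trans (≡.sym (unique (L.sound x∈))) (unique (L.sound y∈)))
    same-col : ∀ {i i′ j} → (i , j) ∈ₗ xs → (i′ , j) ∈ₗ xs → (i , j) ≡ (i′ , j)
    same-col x∈ y∈ with coversV (proj₂ (inside (L.sound x∈)))
    ... | _ , _ , unique = cong (_, _) (≡.trans (≡.sym (unique (L.sound x∈))) (unique (L.sound y∈)))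
    row⁺ : ∀ {i} → i ∈ₗ rows xs → i ∈ₗ is
    row⁺ i∈ with ∈-map⁻ proj₁ i∈
    ... | _ , e∈ , refl = S.complete (proj₁ (inside (L.sound e∈)))
    row⁻ : ∀ {i} → i ∈ₗ is → i ∈ₗ rows xs
    row⁻ i∈ = ∈-map⁺ proj₁ (L.complete (proj₁ (proj₂ (coversU (S.sound i∈)))))
    col⁺ : ∀ {j} → j ∈ₗ cols xs → j ∈ₗ js
    col⁺ j∈ with ∈-map⁻ proj₂ j∈
    ... | _ , e∈ , refl = T.complete (proj₂ (inside (L.sound e∈)))
    col⁻ : ∀ {j} → j ∈ₗ js → j ∈ₗ cols xs
    col⁻ j∈ = ∈-map⁺ proj₂ (L.complete (proj₁ (proj₂ (coversV (T.sound j∈)))))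

  -- The permutations supply an edge at each vertex; its uniqueness comes from the absence of
  -- duplicates in the row and column lists.
  ↭⇒perfect : rows xs ↭ is → cols xs ↭ js → IsPerfectMatchingOn S T M
  ↭⇒perfect rows↭ cols↭ = record
    { inside = λ j∈ → S.sound (∈-resp-↭ rows↭ (∈-map⁺ proj₁ (L.complete j∈))) ,
                      T.sound (∈-resp-↭ cols↭ (∈-map⁺ proj₂ (L.complete j∈)))
    ; coversU = coversU
    ; coversV = coversV }
    where
    coversU : ∀ {i} → S i → ∃! _≡_ λ j → [u i ,v j ]∈ M
    coversU i∈S with ∈-map⁻ proj₁ (∈-resp-↭ (↭-sym rows↭) (S.complete i∈S))
    ... | (_ , j) , e∈ , refl = j , L.sound e∈ , λ j′∈ → cong proj₂
      (map-unique⇒injective proj₁ (Unique-↭ (↭-sym rows↭) S.unique) e∈ (L.complete j′∈) refl)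
    coversV : ∀ {j} → T j → ∃! _≡_ λ i → [u i ,v j ]∈ M
    coversV j∈T with ∈-map⁻ proj₂ (∈-resp-↭ (↭-sym cols↭) (T.complete j∈T))
    ... | (i , _) , e∈ , refl = i , L.sound e∈ , λ i′∈ → cong proj₁
      (map-unique⇒injective proj₂ (Unique-↭ (↭-sym cols↭) T.unique) e∈ (L.complete i′∈) refl)

-- Existence of minimizers

-- Excluded middle decides `P` and compares real values. `x₀` covers the empty list, so the
-- minimizer need not itself occur in `xs`.
argmin : ExcludedMiddle 0ℓ → ∀ {X : Set} (P : X → Set) (f : X → ℝ) {x₀} → P x₀ → ∀ xs →
         ∃ λ x → P x × (∀ {y} → y ∈ₗ xs → P y → f x ≼ f y)
argmin em P f {x₀} Px₀ [] = x₀ , Px₀ , λ ()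
argmin em P f Px₀ (x ∷ xs) with argmin em P f Px₀ xs | em {P x}
... | z , Pz , min | no ¬Px = z , Pz , λ { (here refl) Py → contradiction Py ¬Px ; (there y∈) → min y∈ }
... | z , Pz , min | yes Px with ≼-total em (f x) (f z)
...   | inj₁ x≼z = x , Px , λ { (here refl) _ → ≼-refl ; (there y∈) Py → ≼-trans x≼z (min y∈ Py) }
...   | inj₂ z≼x = z , Pz , λ { (here refl) _ → z≼x ; (there y∈) Py → min y∈ Py }

words : ∀ {E : Set} → List E → ℕ → List (List E)
words es zero = [] ∷ []
words es (suc l) = cartesianProductWith _∷_ es (words es l)

∈-words : ∀ {E : Set} {es : List E} → (∀ e → e ∈ₗ es) → ∀ xs → xs ∈ₗ words es (length xs)
∈-words full [] = here refl
∈-words full (x ∷ xs) = ∈-cartesianProductWith⁺ _∷_ (full x) (∈-words full xs)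

-- A list with these rows has the length of `is`, so it is one of finitely many words over all
-- edges; the diagonal is the candidate that starts the search.
min-matching : ExcludedMiddle 0ℓ → ∀ {n} (c : Matrix n) (is : List (Fin n)) →
               ∃ λ zs → (rows zs ↭ is × cols zs ↭ is) ×
                        (∀ {xs} → rows xs ↭ is → cols xs ↭ is → total c zs ≼ total c xs)
min-matching em {n} c is
  with argmin em (λ zs → rows zs ↭ is × cols zs ↭ is) (total c) {map diagonal is} (rows-diagonal , cols-diagonal)
         (words (cartesianProduct (allFin n) (allFin n)) (length is))
  where
  rows-diagonal : rows (map diagonal is) ↭ is
  rows-diagonal = ↭-reflexive (≡.trans (≡.sym (List.map-∘ is)) (List.map-id is))
  cols-diagonal : cols (map diagonal is) ↭ is
  cols-diagonal = ↭-reflexive (≡.trans (≡.sym (List.map-∘ is)) (List.map-id is))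
... | zs , zs-perfect , min = zs , zs-perfect , λ {xs} rows↭ cols↭ →
  min (subst (λ l → xs ∈ₗ words _ l) (≡.trans (≡.sym (length-map proj₁ xs)) (↭-length rows↭))
        (∈-words (λ (i , j) → ∈-cartesianProduct⁺ (∈-allFin i) (∈-allFin j)) xs))
      (rows↭ , cols↭)

-- Comparison of `Inner` with `Middle` and `Outer`, and auxiliary lemmas on lists

Inner⇔Middle : ∀ {n t} {i : Fin n} → Inner t i ⇔ Middle t i
Inner⇔Middle {n} {t} {i} = mk⇔ to from
  where
  to : Inner t i → Middle t i
  to (t≤i , t≤i′) = ℕ.s≤s t≤i , ℕ.m+n≤o⇒m≤o∸n (index i)
    (ℕ.≤-trans (ℕ.+-monoʳ-≤ (index i) t≤i′) (ℕ.≤-reflexive (toℕ-opposite i)))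
  from : Middle t i → Inner t i
  from (t<i , i≤n-t) = ℕ.≤-pred t<i , ℕ.+-cancelˡ-≤ (index i) _ _ (ℕ.≤-trans i+t≤n (ℕ.≤-reflexive (≡.sym (toℕ-opposite i))))
    where
    t≤n : t ≤ℕ n
    t≤n = ℕ.≤-trans (ℕ.≤-pred t<i) (ℕ.<⇒≤ (Fin.toℕ<n i))
    i+t≤n : index i ℕ.+ t ≤ℕ n
    i+t≤n = ℕ.m≤o∸n⇒m+n≤o (index i) t≤n i≤n-t

Outer⇒¬Inner : ∀ {n t} {i : Fin n} → Outer t i → ¬ Inner t i
Outer⇒¬Inner (inj₁ i<t) (t≤i , _) = ℕ.<⇒≱ i<t t≤i
-- In the upper block `index i + t ≥ n + 1`, whereas inner indices satisfy `index i + t ≤ n`.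
Outer⇒¬Inner {n} {t} {i} (inj₂ n-t<i) (_ , t≤i′) = ℕ.<-irrefl refl (begin-strict
  n                                   <⟨ ℕ.n<1+n n ⟩
  suc n                               ≤⟨ ℕ.m≤n+m∸n (suc n) t ⟩
  t ℕ.+ (suc n ∸ t)                   ≤⟨ ℕ.+-monoʳ-≤ t n-t<i ⟩
  t ℕ.+ index i                       ≡⟨ ℕ.+-comm t (index i) ⟩
  index i ℕ.+ t                       ≤⟨ ℕ.+-monoʳ-≤ (index i) t≤i′ ⟩
  index i ℕ.+ toℕ (opposite i)        ≡⟨ toℕ-opposite i ⟩
  n                                   ∎)
  where open ℕ.≤-Reasoning

extract-sublist : ∀ {E : Set} {xs ys : List E} → Unique xs → All (_∈ₗ ys) xs → ∃ λ zs → ys ↭ xs ++ zs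
extract-sublist [] [] = _ , ↭-refl
extract-sublist {xs = x ∷ xs} (x∉xs ∷ xs!) (x∈ys ∷ xs⊆ys) with ∈-∃++ x∈ys
... | as , bs , refl with extract-sublist xs! (All.zipWith drop-head (x∉xs , xs⊆ys))
  where
  drop-head : ∀ {z} → x ≢ z × z ∈ₗ as ++ x ∷ bs → z ∈ₗ as ++ bs
  drop-head (x≢z , z∈) with ∈-resp-↭ (shift x as bs) z∈
  ... | here refl = contradiction refl x≢z
  ... | there z∈′ = z∈′
...   | zs , rest↭ = zs , ↭-trans (shift x as bs) (↭.prep x rest↭)

++-cancelˡ-↭ : ∀ {E : Set} (xs : List E) {ys zs} → xs ++ ys ↭ xs ++ zs → ys ↭ zs
++-cancelˡ-↭ [] p = p
++-cancelˡ-↭ (x ∷ xs) p = ++-cancelˡ-↭ xs (drop-∷ p)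

-- A lone edge is determined by its row and its column; this settles the edge left over by the
-- layers when `n ∸ k` is odd.
singleton-rest : ∀ {n} {xs ys : List (Edge n)} → length xs ≤ℕ 1 → rows xs ↭ rows ys → cols xs ↭ cols ys → xs ≡ ys
singleton-rest {xs = []} {[]} _ _ _ = refl
singleton-rest {xs = []} {_ ∷ _} _ p _ = contradiction (↭-length p) λ ()
singleton-rest {xs = _ ∷ []} {[]} _ p _ = contradiction (↭-length p) λ ()
singleton-rest {xs = _ ∷ []} {_ ∷ _ ∷ _} _ p _ = contradiction (↭-length p) λ ()
singleton-rest {xs = _ ∷ []} {_ ∷ []} _ p q with ↭-singleton-inv p | ↭-singleton-inv q
... | refl | refl = refl
singleton-rest {xs = _ ∷ _ ∷ _} (ℕ.s≤s ())

halve : ∀ d → ∃ λ ℓ → ℓ ≤ℕ 1 × d ≡ ⌊ d /2⌋ ℕ.+ ⌊ d /2⌋ ℕ.+ ℓ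
halve zero = 0 , ℕ.z≤n , refl
halve (suc zero) = 1 , ℕ.≤-refl , refl
halve (suc (suc d)) with halve d
... | ℓ , ℓ≤1 , eq = ℓ , ℓ≤1 , ≡.trans (cong (suc ∘ suc) eq) (≡.sym (cong (λ x → suc x ℕ.+ ℓ) (ℕ.+-suc ⌊ d /2⌋ ⌊ d /2⌋)))

enumerates-U : ∀ {n} → Enumerates {n} U (allFin n)
enumerates-U = record { unique = Unique.allFin⁺ _ ; sound = λ _ → _ ; complete = λ {i} _ → ∈-allFin i }

enumerates-Middle : ∀ {n} t → Enumerates {n} (Middle t) (inner t)
enumerates-Middle t = record
  { unique = inner! t
  ; sound = λ i∈ → Equivalence.to Inner⇔Middle (∈-inner⁻ i∈)
  ; complete = λ i∈ → ∈-inner⁺ (Equivalence.from Inner⇔Middle i∈) }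

-- Construction of an optimal pair

module Construction {n k : ℕ} (k≤n : k ≤ℕ n) {A B : Matrix n} where

  m : ℕ
  m = ⌊ n ∸ k /2⌋

  private
    half = halve (n ∸ k)
    ℓ = proj₁ half

    n-k≡ : n ∸ k ≡ m ℕ.+ m ℕ.+ ℓ
    n-k≡ = proj₂ (proj₂ half)

    2m≤n-k : m ℕ.+ m ≤ℕ n ∸ k
    2m≤n-k = ℕ.≤-trans (ℕ.m≤m+n _ ℓ) (ℕ.≤-reflexive (≡.sym n-k≡))

  2m≤n : m ℕ.+ m ≤ℕ n
  2m≤n = ℕ.≤-trans 2m≤n-k (ℕ.m∸n≤m n k)

  -- The inner part has `n - 2m` indices, and `2m ≤ n - k`.
  k≤length-inner : k ≤ℕ length (inner {n} m)
  k≤length-inner = ℕ.+-cancelˡ-≤ (m ℕ.+ m) _ _ (begin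
    m ℕ.+ m ℕ.+ k                       ≤⟨ ℕ.+-monoˡ-≤ k 2m≤n-k ⟩
    n ∸ k ℕ.+ k                         ≡⟨ ℕ.m∸n+n≡m k≤n ⟩
    n                                   ≡⟨ length-inner m 2m≤n ⟨
    m ℕ.+ m ℕ.+ length (inner {n} m)    ∎)
    where open ℕ.≤-Reasoning

  solutionᴬ solutionᴮ : List (Edge n) → List (Edge n)
  solutionᴬ zs = map diagonal (outer m) ++ zs
  solutionᴮ zs = map antidiagonal (outer m) ++ zs

  module _ (monge : Monge A) (anti : AntiMonge B) {N₁ N₂} (feasible : RecovAP.Feasible A B k N₁ N₂) where

    open Peeling {A = A} {B = B} monge anti
    open RecovAP.Feasible feasible

    private
      common-edges common′ : List (Edge n)
      common-edges = edges (N₁ ∩ N₂)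
      -- Exactly `k` common edges are kept and any further ones count as non-common, so that the
      -- number of edges to be peeled is `n ∸ k` for every feasible pair.
      common′ = take k common-edges

      common-unique : Unique common′
      common-unique = Unique.take⁺ k (Lists.unique (lists-edges (N₁ ∩ N₂)))

      length-common′ : length common′ ≡ k
      length-common′ = ≡.trans (List.length-take k common-edges)
        (ℕ.m≤n⇒m⊓n≡m (subst (k ≤ℕ_) (≡.sym (length-edges (N₁ ∩ N₂))) common))

      in-both : ∀ {i j} → (i , j) ∈ₗ common-edges → [u i ,v j ]∈ N₁ × [u i ,v j ]∈ N₂
      in-both {i} e∈ = x∈p∩q⁻ (N₁ i) (N₂ i) (Lists.sound (lists-edges (N₁ ∩ N₂)) e∈)

      start : ∃ (λ zs → edges N₁ ↭ common′ ++ zs) → ∃ (λ zs → edges N₂ ↭ common′ ++ zs) →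
              rows (edges N₁) ↭ allFin n × cols (edges N₁) ↭ allFin n →
              rows (edges N₂) ↭ allFin n × cols (edges N₂) ↭ allFin n →
              Peeled (edges N₁) (edges N₂) k (m ℕ.+ m ℕ.+ ℓ) 0
      start (xs , N₁↭) (ys , N₂↭) (rows₁ , cols₁) (rows₂ , cols₂) = record
        { length-common = length-common′
        ; length-restᴬ = length-rest
        ; improvesᴬ = ↭⇒⇝ (↭-trans N₁↭ (++⁺ʳ _ (map⁺ diagonal (↭-sym outer-zero))))
        ; improvesᴮ = ↭⇒⇝ (↭-trans N₂↭ (++⁺ʳ _ (map⁺ antidiagonal (↭-sym outer-zero))))
        ; rows-↭′ = same proj₁ (↭-trans rows₁ (↭-sym rows₂))
        ; cols-↭′ = same proj₂ (↭-trans cols₁ (↭-sym cols₂))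
        ; rows-inner = ↭-trans (map⁺ proj₁ (↭-sym N₁↭)) (↭-trans rows₁ (↭-sym inner-zero))
        ; cols-inner = ↭-trans (map⁺ proj₂ (↭-sym N₁↭)) (↭-trans cols₁ (↭-sym inner-zero)) }
        where
        same : ∀ (f : Edge n → Fin n) → map f (edges N₁) ↭ map f (edges N₂) → map f xs ↭ map f ys
        same f p = ++-cancelˡ-↭ (map f common′) (↭-trans (↭-reflexive (≡.sym (map-++ f common′ xs)))
          (↭-trans (map⁺ f (↭-sym N₁↭)) (↭-trans p (↭-trans (map⁺ f N₂↭) (↭-reflexive (map-++ f common′ ys))))))

        length-rest : length xs ≡ m ℕ.+ m ℕ.+ ℓ
        length-rest = ℕ.+-cancelˡ-≡ k _ _ (begin
          k ℕ.+ length xs                      ≡⟨ cong (ℕ._+ length xs) length-common′ ⟨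
          length common′ ℕ.+ length xs         ≡⟨ length-++ common′ ⟨
          length (common′ ++ xs)               ≡⟨ ↭-length N₁↭ ⟨
          length (edges N₁)                    ≡⟨ length-map proj₁ (edges N₁) ⟨
          length (rows (edges N₁))             ≡⟨ ↭-length rows₁ ⟩
          length (allFin n)                    ≡⟨ List.length-tabulate id ⟩
          n                                    ≡⟨ ℕ.m+[n∸m]≡n k≤n ⟨
          k ℕ.+ (n ∸ k)                        ≡⟨ cong (k ℕ.+_) n-k≡ ⟩
          k ℕ.+ (m ℕ.+ m ℕ.+ ℓ)                ∎)
          where open ≡.≡-Reasoning

      -- At most one non-common edge is left in each matching, and the two coincide, so a single
      -- `zs` completes both.
      finish : Peeled (edges N₁) (edges N₂) k ℓ m →
               ∃ λ zs → (rows zs ↭ inner m × cols zs ↭ inner m) ×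
                        edges N₁ ⇝[ A ] solutionᴬ zs × edges N₂ ⇝[ B ] solutionᴮ zs
      finish P = P.common ++ P.restᴬ , (P.rows-inner , P.cols-inner) , P.improvesᴬ ,
        subst (λ ys → edges N₂ ⇝[ B ] solutionᴮ (P.common ++ ys))
          (≡.sym (singleton-rest (subst (_≤ℕ 1) (≡.sym P.length-restᴬ) (proj₁ (proj₂ half))) P.rows-↭′ P.cols-↭′))
          P.improvesᴮ
        where module P = Peeled P

    -- Reduces an arbitrary feasible pair to a choice of `zs` on the inner block at no greater cost;
    -- optimality becomes a question about `zs` alone.
    improve : ∃ λ zs → (rows zs ↭ inner m × cols zs ↭ inner m) ×
                       edges N₁ ⇝[ A ] solutionᴬ zs × edges N₂ ⇝[ B ] solutionᴮ zs
    improve = finish (peel m 2m≤n (start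
      (extract-sublist common-unique (All.take⁺ k (All.tabulate (Lists.complete (lists-edges N₁) ∘ proj₁ ∘ in-both))))
      (extract-sublist common-unique (All.take⁺ k (All.tabulate (Lists.complete (lists-edges N₂) ∘ proj₂ ∘ in-both))))
      (perfect⇒↭ enumerates-U enumerates-U (lists-edges N₁) perfect₁)
      (perfect⇒↭ enumerates-U enumerates-U (lists-edges N₂) perfect₂)))

  A+B : Matrix n
  A+B i j = A i j + B i j

  -- The outer edges contribute a constant, so the total cost depends on `zs` only through the
  -- matrix `A+B`.
  total-solution : ∀ zs → total A (solutionᴬ zs) + total B (solutionᴮ zs) ≈
                          (total A (map diagonal (outer m)) + total B (map antidiagonal (outer m))) + total A+B zs
  total-solution zs = begin
    total A (solutionᴬ zs) + total B (solutionᴮ zs)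
      ≈⟨ ∙-cong (sum-++ (uncurry A) (map diagonal (outer m)) zs) (sum-++ (uncurry B) (map antidiagonal (outer m)) zs) ⟩
    (total A (map diagonal (outer m)) + total A zs) + (total B (map antidiagonal (outer m)) + total B zs)
      ≈⟨ interchange _ _ _ _ ⟩
    (total A (map diagonal (outer m)) + total B (map antidiagonal (outer m))) + (total A zs + total B zs)
      ≈⟨ ∙-congˡ (sum-∙ (uncurry A) (uncurry B) zs) ⟨
    (total A (map diagonal (outer m)) + total B (map antidiagonal (outer m))) + total A+B zs ∎
    where
    open CommutativeMonoid +-0-commutativeMonoid using (∙-cong; ∙-congˡ; setoid; commutativeSemigroup)
    open import Algebra.Properties.CommutativeSemigroup commutativeSemigroup using (interchange)
    open import Relation.Binary.Reasoning.Setoid setoid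

  module _ {zs : List (Edge n)} (rows↭ : rows zs ↭ inner m) (cols↭ : cols zs ↭ inner m) where

    private
      rows-solution : ∀ (f : Fin n → Edge n) → (∀ i → proj₁ (f i) ≡ i) → rows (map f (outer m) ++ zs) ↭ allFin n
      rows-solution f first = ↭-trans (↭-reflexive (map-++ proj₁ (map f (outer m)) zs)) (↭-trans
        (++⁺ (↭-reflexive (≡.trans (≡.sym (List.map-∘ (outer m))) (≡.trans (List.map-cong first (outer m)) (List.map-id (outer m))))) rows↭)
        (inner++outer m))

    cols-solutionᴬ : cols (solutionᴬ zs) ↭ allFin n
    cols-solutionᴬ = ↭-trans (↭-reflexive (map-++ proj₂ (map diagonal (outer m)) zs)) (↭-trans
      (++⁺ (↭-reflexive (≡.trans (≡.sym (List.map-∘ (outer m))) (List.map-id (outer m)))) cols↭) (inner++outer m))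

    cols-solutionᴮ : cols (solutionᴮ zs) ↭ allFin n
    cols-solutionᴮ = ↭-trans (↭-reflexive (map-++ proj₂ (map antidiagonal (outer m)) zs)) (↭-trans
      (++⁺ (↭-trans (↭-reflexive (≡.sym (List.map-∘ (outer m)))) (opposite-outer m)) cols↭) (inner++outer m))

    rows-solutionᴬ : rows (solutionᴬ zs) ↭ allFin n
    rows-solutionᴬ = rows-solution diagonal (λ _ → refl)

    rows-solutionᴮ : rows (solutionᴮ zs) ↭ allFin n
    rows-solutionᴮ = rows-solution antidiagonal (λ _ → refl)

    lists-solutionᴬ : Lists (fromList (solutionᴬ zs)) (solutionᴬ zs)
    lists-solutionᴬ = lists-fromList (Unique.map⁻ (Unique-↭ (↭-sym rows-solutionᴬ) (Unique.allFin⁺ n)))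

    lists-solutionᴮ : Lists (fromList (solutionᴮ zs)) (solutionᴮ zs)
    lists-solutionᴮ = lists-fromList (Unique.map⁻ (Unique-↭ (↭-sym rows-solutionᴮ) (Unique.allFin⁺ n)))

    lists-common : Lists (fromList (solutionᴬ zs) ∩ fromList (solutionᴮ zs)) zs
    lists-common = record
      { unique = Unique.map⁻ (Unique-↭ (↭-sym rows↭) (inner! m))
      ; sound = λ e∈ → x∈p∩q⁺ (Lists.sound lists-solutionᴬ (∈-++⁺ʳ (map diagonal (outer m)) e∈) ,
                               Lists.sound lists-solutionᴮ (∈-++⁺ʳ (map antidiagonal (outer m)) e∈))
      ; complete = λ {i} {j} e∈ → let ∈ᴬ , ∈ᴮ = x∈p∩q⁻ (fromList (solutionᴬ zs) i) _ e∈ in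
          both (∈-++⁻ (map diagonal (outer m)) (Lists.complete lists-solutionᴬ {i} {j} ∈ᴬ))
               (∈-++⁻ (map antidiagonal (outer m)) (Lists.complete lists-solutionᴮ {i} {j} ∈ᴮ)) }
      where
      both : ∀ {i j} → (i , j) ∈ₗ map diagonal (outer m) ⊎ (i , j) ∈ₗ zs →
             (i , j) ∈ₗ map antidiagonal (outer m) ⊎ (i , j) ∈ₗ zs → (i , j) ∈ₗ zs
      both (inj₂ e∈) _ = e∈
      both (inj₁ _) (inj₂ e∈) = e∈
      both (inj₁ d∈) (inj₁ a∈) with ∈-map⁻ diagonal d∈ | ∈-map⁻ antidiagonal a∈
      -- An edge both diagonal and antidiagonal would give an outer index fixed by `opposite`.
      ... | i , i∈ , refl | _ , _ , eq = contradiction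
        (≡.trans (cong proj₂ eq) (cong (opposite ∘ proj₁) (≡.sym eq))) (opposite≢ 2m≤n (∈-outer⁻ {t = m} i∈))

    solution-feasible : RecovAP.Feasible A B k (fromList (solutionᴬ zs)) (fromList (solutionᴮ zs))
    solution-feasible = record
      { perfect₁ = ↭⇒perfect enumerates-U enumerates-U lists-solutionᴬ rows-solutionᴬ cols-solutionᴬ
      ; perfect₂ = ↭⇒perfect enumerates-U enumerates-U lists-solutionᴮ rows-solutionᴮ cols-solutionᴮ
      ; common = subst (k ≤ℕ_) (≡.sym length-common) k≤length-inner }
      where
      length-common : ∣ fromList (solutionᴬ zs) ∩ fromList (solutionᴮ zs) ∣ ≡ length (inner {n} m)
      length-common = ≡.trans (∣∣≡length lists-common) (≡.trans (≡.sym (length-map proj₁ zs)) (↭-length rows↭))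

    module _ (monge : Monge A) (anti : AntiMonge B)
             (min : ∀ {xs} → rows xs ↭ inner m → cols xs ↭ inner m → total A+B zs ≼ total A+B xs) where

      -- Any competitor is first improved to the solution form, whose inner list is then compared
      -- with the minimal `zs`.
      solution-optimal : RecovAP.Optimal A B k (fromList (solutionᴬ zs)) (fromList (solutionᴮ zs))
      solution-optimal = record { feasible = solution-feasible ; minimal = λ N₁ N₂ f → ⊆-cut (minimal N₁ N₂ f) }
        where
        open ≼-Reasoning
        minimal : ∀ N₁ N₂ → RecovAP.Feasible A B k N₁ N₂ →
                  cost A (fromList (solutionᴬ zs)) + cost B (fromList (solutionᴮ zs)) ≼ cost A N₁ + cost B N₂
        minimal N₁ N₂ feasible with improve monge anti feasible
        ... | xs , (rows-xs , cols-xs) , improvesᴬ , improvesᴮ = begin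
          cost A (fromList (solutionᴬ zs)) + cost B (fromList (solutionᴮ zs))
            ≤⟨ +-mono (proj₁ (cost≈total lists-solutionᴬ A)) (proj₁ (cost≈total lists-solutionᴮ B)) ⟩
          total A (solutionᴬ zs) + total B (solutionᴮ zs)
            ≈⟨ total-solution zs ⟩
          (total A (map diagonal (outer m)) + total B (map antidiagonal (outer m))) + total A+B zs
            ≤⟨ +-mono ≼-refl (min rows-xs cols-xs) ⟩
          (total A (map diagonal (outer m)) + total B (map antidiagonal (outer m))) + total A+B xs
            ≈⟨ total-solution xs ⟨
          total A (solutionᴬ xs) + total B (solutionᴮ xs)
            ≤⟨ +-mono (cheaper improvesᴬ) (cheaper improvesᴮ) ⟩
          total A (edges N₁) + total B (edges N₂)
            ≤⟨ +-mono (proj₁ (cost-edges N₁ A)) (proj₁ (cost-edges N₂ B)) ⟩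
          cost A N₁ + cost B N₂ ∎

      common-optimal : IsMinCostPerfectMatchingOn (Middle m) (Middle m) A+B
                         (fromList (solutionᴬ zs) ∩ fromList (solutionᴮ zs))
      common-optimal = record
        { perfect = ↭⇒perfect (enumerates-Middle m) (enumerates-Middle m) lists-common rows↭ cols↭
        ; minimal = λ N perfect → ⊆-cut (minimal N (perfect⇒↭ (enumerates-Middle m) (enumerates-Middle m) (lists-edges N) perfect)) }
        where
        minimal : ∀ N → rows (edges N) ↭ inner m × cols (edges N) ↭ inner m →
                  cost A+B (fromList (solutionᴬ zs) ∩ fromList (solutionᴮ zs)) ≼ cost A+B N
        minimal N (rows-N , cols-N) = ≼-trans (proj₁ (cost≈total lists-common A+B))
          (≼-trans (min rows-N cols-N) (proj₁ (cost-edges N A+B)))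

theorem6 : ExcludedMiddle 0ℓ →
    ∀ (n k : ℕ) → k ≤ℕ n →
    (A B : Matrix n) → Monge A → AntiMonge B →
    let m = ⌊ n ∸ k /2⌋ in
    ∃₂ λ (M₁ M₂ : EdgeSet n) →
    RecovAP.Optimal A B k M₁ M₂
    × (∀ i → Outer m i → [u i ,v i ]∈ M₁)
    × (∀ i → Outer m i → [u i ,v opposite i ]∈ M₂)
    × IsMinCostPerfectMatchingOn (Middle m) (Middle m) (λ i j → A i j + B i j) (M₁ ∩ M₂)
theorem6 em n k k≤n A B monge anti =
  let open Construction {n} {k} k≤n {A} {B}
      -- The inner block is solved to optimality first, without reference to any feasible pair.
      zs , (rows↭ , cols↭) , min = min-matching em A+B (inner m)
      outer-member : ∀ {i} → Outer m i → i ∈ₗ outer m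
      outer-member o = ∈-outer⁺ {t = m} (Outer⇒¬Inner o)
  in
  fromList (solutionᴬ zs) , fromList (solutionᴮ zs) ,
  solution-optimal rows↭ cols↭ monge anti min ,
  (λ i o → Lists.sound (lists-solutionᴬ rows↭ cols↭) (∈-++⁺ˡ (∈-map⁺ diagonal (outer-member o)))) ,
  (λ i o → Lists.sound (lists-solutionᴮ rows↭ cols↭) (∈-++⁺ˡ (∈-map⁺ antidiagonal (outer-member o)))) ,
  common-optimal rows↭ cols↭ monge anti min
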